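{- Let $(G,c)$ be a tensor network template. Suppose there is an integer $d>0$ such that for every edge $e$ the capacity $c_e$ is a power of $d$ (that is, $c_e=d^{m_e}$ with $m_e\in\mathbb{Z}_{\ge0}$). Then $\mathrm{QMF}(G,c)=\mathrm{QMC}(G,c)$.
   Context: A tensor network template $(G,c)$ consists of a finite undirected graph $G$ (multiple edges allowed) with edge set $E$ whose vertex set is partitioned as $S\sqcup T\sqcup V$. Every element of $S$ (inputs) and every element of $T$ (outputs) is an open end of degree $1$; the elements of $V$ are called vertices. For $u\in S\sqcup T$, $e(u)$ denotes the edge incident to $u$. A capacity function $c:E\to\mathbb{Z}_{>0}$ is given, and to each edge $e$ one associates $\mathbb{C}^{c_e}$ with a fixed basis. At each vertex $v$ of degree $d_v$ an ordering $e(v,1),\dots,e(v,d_v)$ of the incident edge-ends is fixed. A tensor assignment $\mathcal T=(\mathcal T_v)_{v\in V}$ chooses $\mathcal T_v\in\bigotimes_{i=1}^{d_v}\mathbb{C}^{c_{e(v,i)}}$ for each $v$. Let $V_S=\bigotimes_{u\in S}\mathbb{C}^{c_{e(u)}}$ and $V_T=\bigotimes_{u\in T}\mathbb{C}^{c_{e(u)}}$. Contracting the network along all edges gives $\beta(G,c;\mathcal T)\in\mathrm{Hom}(V_S,V_T)$, whose matrix entries are $\langle I_T|\beta|I_S\rangle=\sum_W\prod_{v\in V}(\mathcal T_v)_{W|_v}$. Here $W$ ranges over all assignments of basis indices to all edges that agree with $I_S$ on the input edges and with $I_T$ on the output edges, and $W|_v$ is the tuple of indices on $e(v,1),\dots,e(v,d_v)$.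 The quantum max-flow is $\mathrm{QMF}(G,c)=\max_{\mathcal T}\operatorname{rank}\beta(G,c;\mathcal T)$. An edge cut set is a set $C\subseteq E$ for which there is a partition $S\sqcup T\sqcup V=\bar S\sqcup\bar T$ with $S\subseteq\bar S$, $T\subseteq\bar T$, and $C$ equal to the set of edges having one endpoint in $\bar S$ and the other in $\bar T$. The quantum min-cut is $\mathrm{QMC}(G,c)=\min_C\prod_{e\in C}c_e$, the minimum taken over all edge cut sets $C$. -}

module Defs where

open import Level using (0ℓ)
open import Algebra.Bundles using (CommutativeRing)
open import Data.Bool.Base using (Bool; true; false; if_then_else_)
open import Data.Fin.Base using (Fin)
open import Data.Fin.Patterns using (0F; 1F)
open import Data.Fin.Properties using (all?) renaming (_≟_ to _≟ᶠ_)
open import Data.Fin.Subset using (Subset; _∈_)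
open import Data.Fin.Subset.Properties using (_∈?_)
open import Data.List.Base using (map; filter; allFin)
open import Data.Nat.Base as ℕ using (ℕ)
import Data.Nat.Properties as ℕ
open import Data.Nat.ListAction using (product)
open import Data.Product.Base using (Σ; ∃; _×_; _,_; proj₁; proj₂)
open import Data.Product using (∃!)
open import Data.Rational.Base as ℚ using (ℚ; 0ℚ; 1ℚ; ½)
import Data.Rational.Base as ℚ-Base
import Data.Rational.Properties as ℚ
open import Data.Rational.Solver using (module +-*-Solver)
open import Data.Vec.Base using (Vec; []; _∷_; tabulate)
open import Data.Vec.Relation.Unary.All using (All; []; _∷_)
open import Data.Vec.Relation.Unary.All.Properties using (tabulate⁺; tabulate⁻)
open import Function.Base using (_∘_)
open import Function.Bundles using (_↔_; _⇔_; Inverse)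
open import Relation.Binary.PropositionalEquality
  using (_≡_; _≢_; refl; sym; trans; cong; subst)
open import Relation.Binary.Bundles using (Setoid)
open import Relation.Binary.Structures using (IsEquivalence)
open import Relation.Nullary.Decidable.Core using (Dec; does; _×-dec_)

Close : ℚ → ℚ → ℚ → Set
Close ε a b = ℚ.∣ a ℚ.- b ∣ ℚ.< ε

half+half : ∀ ε → ε ℚ.* ½ ℚ.+ ε ℚ.* ½ ≡ ε
half+half ε = trans (sym (ℚ.*-distribˡ-+ ε ½ ½)) (ℚ.*-identityʳ ε)

half-pos : ∀ {ε} → 0ℚ ℚ.< ε → 0ℚ ℚ.< ε ℚ.* ½
half-pos {ε} 0<ε = ℚ.positive⁻¹ (ε ℚ.* ½) {{ℚ.pos*pos⇒pos ε {{ℚ.positive 0<ε}} ½}}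

∣+∣-< : ∀ {a b ε} → ℚ.∣ a ∣ ℚ.< ε ℚ.* ½ → ℚ.∣ b ∣ ℚ.< ε ℚ.* ½ → ℚ.∣ a ℚ.+ b ∣ ℚ.< ε
∣+∣-< {a} {b} {ε} p q = ℚ.≤-<-trans (ℚ.∣p+q∣≤∣p∣+∣q∣ a b)
  (subst (ℚ.∣ a ∣ ℚ.+ ℚ.∣ b ∣ ℚ.<_) (half+half ε) (ℚ.+-mono-< p q))

∣*∣-< : ∀ {a b B δ} → 0ℚ ℚ.< B → ℚ.∣ a ∣ ℚ.< B → ℚ.∣ b ∣ ℚ.< δ → ℚ.∣ a ℚ.* b ∣ ℚ.< B ℚ.* δ
∣*∣-< {a} {b} {B} {δ} 0<B p q = subst (ℚ._< B ℚ.* δ) (sym (ℚ.∣p*q∣≡∣p∣*∣q∣ a b))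
  (ℚ.≤-<-trans
    (ℚ.*-monoʳ-≤-nonNeg ℚ.∣ b ∣ {{ℚ.∣-∣-nonNeg b}} (ℚ.<⇒≤ p))
    (ℚ.*-monoʳ-<-pos B {{ℚ.positive 0<B}} q))

Close-refl : ∀ {ε} a → 0ℚ ℚ.< ε → Close ε a a
Close-refl {ε} a = subst (ℚ._< ε) (sym (cong ℚ.∣_∣ (ℚ.+-inverseʳ a)))

Close-sym : ∀ {ε a b} → Close ε a b → Close ε b a
Close-sym {ε} {a} {b} = subst (ℚ._< ε)
  (trans (sym (ℚ.∣-p∣≡∣p∣ (a ℚ.- b))) (cong ℚ.∣_∣ (eq a b)))
  where
  open +-*-Solver
  eq : ∀ a b → ℚ.- (a ℚ.- b) ≡ b ℚ.- a
  eq = solve 2 (λ a b → :- (a :- b) := b :- a) refl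

Close-trans : ∀ {ε a b c} → Close (ε ℚ.* ½) a b → Close (ε ℚ.* ½) b c → Close ε a c
Close-trans {ε} {a} {b} {c} p q =
  subst (ℚ._< ε) (cong ℚ.∣_∣ (eq a b c)) (∣+∣-< {a ℚ.- b} {b ℚ.- c} p q)
  where
  open +-*-Solver
  eq : ∀ a b c → (a ℚ.- b) ℚ.+ (b ℚ.- c) ≡ a ℚ.- c
  eq = solve 3 (λ a b c → (a :- b) :+ (b :- c) := a :- c) refl

Close-+ : ∀ {ε a a′ b b′} → Close (ε ℚ.* ½) a a′ → Close (ε ℚ.* ½) b b′ →
          Close ε (a ℚ.+ b) (a′ ℚ.+ b′)
Close-+ {ε} {a} {a′} {b} {b′} p q =
  subst (ℚ._< ε) (cong ℚ.∣_∣ (eq a a′ b b′)) (∣+∣-< {a ℚ.- a′} {b ℚ.- b′} p q)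
  where
  open +-*-Solver
  eq : ∀ a a′ b b′ → (a ℚ.- a′) ℚ.+ (b ℚ.- b′) ≡ (a ℚ.+ b) ℚ.- (a′ ℚ.+ b′)
  eq = solve 4 (λ a a′ b b′ → (a :- a′) :+ (b :- b′) := (a :+ b) :- (a′ :+ b′)) refl

Close-neg : ∀ {ε a b} → Close ε a b → Close ε (ℚ.- a) (ℚ.- b)
Close-neg {ε} {a} {b} p = subst (ℚ._< ε) (cong ℚ.∣_∣ (eq a b)) (Close-sym {ε} {a} {b} p)
  where
  open +-*-Solver
  eq : ∀ a b → b ℚ.- a ≡ (ℚ.- a) ℚ.- (ℚ.- b)
  eq = solve 2 (λ a b → b :- a := (:- a) :- (:- b)) refl

shrink : ∀ B ε → 0ℚ ℚ.< B → 0ℚ ℚ.< ε → ∃ λ δ → 0ℚ ℚ.< δ × B ℚ.* δ ≡ ε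
shrink B ε 0<B 0<ε = B⁻¹ ℚ.* ε ,
  ℚ.positive⁻¹ (B⁻¹ ℚ.* ε)
    {{ℚ.pos*pos⇒pos B⁻¹ {{ℚ.1/pos⇒pos B}} ε {{ℚ.positive 0<ε}}}} ,
  trans (sym (ℚ.*-assoc B B⁻¹ ε)) (trans (cong (ℚ._* ε) (ℚ.*-inverseʳ B)) (ℚ.*-identityˡ ε))
  where
  instance
    B-pos : ℚ.Positive B
    B-pos = ℚ.positive 0<B
    B-nonZero : ℚ.NonZero B
    B-nonZero = ℚ.pos⇒nonZero B
  B⁻¹ = ℚ.1/ B

Close-* : ∀ {ε B C a a′ b b′ δ δ′} → 0ℚ ℚ.< B → 0ℚ ℚ.< C →
          B ℚ.* δ ≡ ε ℚ.* ½ → C ℚ.* δ′ ≡ ε ℚ.* ½ →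
          ℚ.∣ a ∣ ℚ.< B → ℚ.∣ b′ ∣ ℚ.< C → Close δ b b′ → Close δ′ a a′ →
          Close ε (a ℚ.* b) (a′ ℚ.* b′)
Close-* {ε} {B} {C} {a} {a′} {b} {b′} {δ} {δ′} 0<B 0<C Bδ Cδ′ ∣a∣<B ∣b′∣<C p q =
  subst (ℚ._< ε) (cong ℚ.∣_∣ (eq a a′ b b′))
    (∣+∣-< {a ℚ.* (b ℚ.- b′)} {b′ ℚ.* (a ℚ.- a′)}
      (subst (ℚ.∣ a ℚ.* (b ℚ.- b′) ∣ ℚ.<_) Bδ (∣*∣-< {a} {b ℚ.- b′} 0<B ∣a∣<B p))
      (subst (ℚ.∣ b′ ℚ.* (a ℚ.- a′) ∣ ℚ.<_) Cδ′ (∣*∣-< {b′} {a ℚ.- a′} 0<C ∣b′∣<C q)))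
  where
  open +-*-Solver
  eq : ∀ a a′ b b′ → a ℚ.* (b ℚ.- b′) ℚ.+ b′ ℚ.* (a ℚ.- a′) ≡ a ℚ.* b ℚ.- a′ ℚ.* b′
  eq = solve 4 (λ a a′ b b′ → a :* (b :- b′) :+ b′ :* (a :- a′) := a :* b :- a′ :* b′) refl

Eventually : (ℕ → Set) → Set
Eventually P = ∃ λ N → ∀ n → N ℕ.≤ n → P n

Eventually-× : ∀ {P Q} → Eventually P → Eventually Q → Eventually (λ n → P n × Q n)
Eventually-× (M , p) (N , q) = M ℕ.⊔ N , λ n le →
  p n (ℕ.≤-trans (ℕ.m≤m⊔n M N) le) , q n (ℕ.≤-trans (ℕ.m≤n⊔m M N) le)

IsCauchy : (ℕ → ℚ) → Set
IsCauchy x = ∀ ε → 0ℚ ℚ.< ε →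
  ∃ λ N → ∀ m n → N ℕ.≤ m → N ℕ.≤ n → Close ε (x m) (x n)

-- Cauchy sequences of rationals up to _≈ℝ_.  No η, and operations by copatterns, so that x +ℝ y does not unfold by itself
record ℝ : Set where
  no-eta-equality
  field
    seq    : ℕ → ℚ
    cauchy : IsCauchy seq
open ℝ public

infix 4 _≈ℝ_
infixl 6 _+ℝ_
infixl 7 _*ℝ_
infix 8 -ℝ_

-- A record, so that x and y can be inferred from a proof of x ≈ℝ y
record _≈ℝ_ (x y : ℝ) : Set where
  constructor mk≈
  field close : ∀ ε → 0ℚ ℚ.< ε → Eventually λ n → Close ε (seq x n) (seq y n)
open _≈ℝ_ public

bounded : ∀ x → ∃ λ B → 0ℚ ℚ.< B × Eventually λ n → ℚ.∣ seq x n ∣ ℚ.< B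
bounded x with cauchy x 1ℚ (ℚ.positive⁻¹ 1ℚ)
... | N , h = B , 0<B , N , bd
  where
  a = seq x N
  B = 1ℚ ℚ.+ ℚ.∣ a ∣
  0<B : 0ℚ ℚ.< B
  0<B = ℚ.positive⁻¹ B {{ℚ.pos+nonNeg⇒pos 1ℚ ℚ.∣ a ∣ {{ℚ.∣-∣-nonNeg a}}}}
  open +-*-Solver
  eq : ∀ b a → (b ℚ.- a) ℚ.+ a ≡ b
  eq = solve 2 (λ b a → (b :- a) :+ a := b) refl
  bd : ∀ n → N ℕ.≤ n → ℚ.∣ seq x n ∣ ℚ.< B
  bd n N≤n = subst (λ q → ℚ.∣ q ∣ ℚ.< B) (eq (seq x n) a)
    (ℚ.≤-<-trans (ℚ.∣p+q∣≤∣p∣+∣q∣ (seq x n ℚ.- a) a)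
      (ℚ.+-mono-<-≤ (h n N N≤n ℕ.≤-refl) (ℚ.≤-refl {ℚ.∣ a ∣})))

ιℝ : ℚ → ℝ
seq    (ιℝ q) _ = q
cauchy (ιℝ q) ε 0<ε = 0 , λ _ _ _ _ → Close-refl q 0<ε

_+ℝ_ : ℝ → ℝ → ℝ
seq    (x +ℝ y) n = seq x n ℚ.+ seq y n
cauchy (x +ℝ y) ε 0<ε =
  let M , p = cauchy x (ε ℚ.* ½) (half-pos 0<ε)
      N , q = cauchy y (ε ℚ.* ½) (half-pos 0<ε)
  in M ℕ.⊔ N , λ m n le le′ →
    Close-+ {a = seq x m} {seq x n} {seq y m} {seq y n}
      (p m n (ℕ.≤-trans (ℕ.m≤m⊔n M N) le) (ℕ.≤-trans (ℕ.m≤m⊔n M N) le′))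
      (q m n (ℕ.≤-trans (ℕ.m≤n⊔m M N) le) (ℕ.≤-trans (ℕ.m≤n⊔m M N) le′))

-ℝ_ : ℝ → ℝ
seq    (-ℝ x) n = ℚ.- seq x n
cauchy (-ℝ x) ε 0<ε =
  let N , p = cauchy x ε 0<ε
  in N , λ m n le le′ → Close-neg {a = seq x m} {seq x n} (p m n le le′)

_*ℝ_ : ℝ → ℝ → ℝ
seq    (x *ℝ y) n = seq x n ℚ.* seq y n
cauchy (x *ℝ y) ε 0<ε =
  let B , 0<B , evB = bounded x
      C , 0<C , evC = bounded y
      δ  , 0<δ  , Bδ  = shrink B (ε ℚ.* ½) 0<B (half-pos 0<ε)
      δ′ , 0<δ′ , Cδ′ = shrink C (ε ℚ.* ½) 0<C (half-pos 0<ε)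
      M , bd = Eventually-× evB evC
      N , q = cauchy y δ 0<δ
      K , p = cauchy x δ′ 0<δ′
      L = M ℕ.⊔ (N ℕ.⊔ K)
      M≤L = ℕ.m≤m⊔n M (N ℕ.⊔ K)
      N≤L = ℕ.≤-trans (ℕ.m≤m⊔n N K) (ℕ.m≤n⊔m M (N ℕ.⊔ K))
      K≤L = ℕ.≤-trans (ℕ.m≤n⊔m N K) (ℕ.m≤n⊔m M (N ℕ.⊔ K))
  in L , λ m n le le′ →
    Close-* {a = seq x m} {seq x n} {seq y m} {seq y n} 0<B 0<C Bδ Cδ′
      (proj₁ (bd m (ℕ.≤-trans M≤L le)))
      (proj₂ (bd n (ℕ.≤-trans M≤L le′)))
      (q m n (ℕ.≤-trans N≤L le) (ℕ.≤-trans N≤L le′))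
      (p m n (ℕ.≤-trans K≤L le) (ℕ.≤-trans K≤L le′))

pointwise⇒≈ℝ : ∀ {x y} → (∀ n → seq x n ≡ seq y n) → x ≈ℝ y
pointwise⇒≈ℝ {x} h = mk≈ λ ε 0<ε → 0 , λ n _ →
  subst (Close ε (seq x n)) (h n) (Close-refl (seq x n) 0<ε)

≈ℝ-isEquivalence : IsEquivalence _≈ℝ_
≈ℝ-isEquivalence = record
  { refl  = pointwise⇒≈ℝ λ _ → refl
  ; sym   = λ {x} {y} e → mk≈ λ ε 0<ε →
      let N , p = close e ε 0<ε
      in N , λ n le → Close-sym {a = seq x n} {seq y n} (p n le)
  ; trans = λ {x} {y} {z} d e → mk≈ λ ε 0<ε →
      let N , p = Eventually-× (close d (ε ℚ.* ½) (half-pos 0<ε))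
                               (close e (ε ℚ.* ½) (half-pos 0<ε))
      in N , λ n le → Close-trans {a = seq x n} {seq y n} {seq z n}
                        (proj₁ (p n le)) (proj₂ (p n le))
  }

+ℝ-cong : ∀ {x x′ y y′} → x ≈ℝ x′ → y ≈ℝ y′ → x +ℝ y ≈ℝ x′ +ℝ y′
+ℝ-cong {x} {x′} {y} {y′} d e = mk≈ λ ε 0<ε →
  let N , p = Eventually-× (close d (ε ℚ.* ½) (half-pos 0<ε))
                           (close e (ε ℚ.* ½) (half-pos 0<ε))
  in N , λ n le → Close-+ {a = seq x n} {seq x′ n} {seq y n} {seq y′ n}
                    (proj₁ (p n le)) (proj₂ (p n le))

-ℝ-cong : ∀ {x y} → x ≈ℝ y → -ℝ x ≈ℝ -ℝ y
-ℝ-cong {x} {y} d = mk≈ λ ε 0<ε →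
  let N , p = close d ε 0<ε
  in N , λ n le → Close-neg {a = seq x n} {seq y n} (p n le)

*ℝ-cong : ∀ {x x′ y y′} → x ≈ℝ x′ → y ≈ℝ y′ → x *ℝ y ≈ℝ x′ *ℝ y′
*ℝ-cong {x} {x′} {y} {y′} d e = mk≈ λ ε 0<ε →
  let B , 0<B , evB = bounded x
      C , 0<C , evC = bounded y′
      δ  , 0<δ  , Bδ  = shrink B (ε ℚ.* ½) 0<B (half-pos 0<ε)
      δ′ , 0<δ′ , Cδ′ = shrink C (ε ℚ.* ½) 0<C (half-pos 0<ε)
      N , p = Eventually-× (Eventually-× evB evC)
                           (Eventually-× (close e δ 0<δ) (close d δ′ 0<δ′))
  in N , λ n le → let (∣x∣<B , ∣y′∣<C) , (q , r) = p n le in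
    Close-* {a = seq x n} {seq x′ n} {seq y n} {seq y′ n} 0<B 0<C Bδ Cδ′ ∣x∣<B ∣y′∣<C q r

infix 4 _≈ℂ_
infixl 6 _+ℂ_
infixl 7 _*ℂ_

record ℂ : Set where
  no-eta-equality
  field
    re im : ℝ
open ℂ public

record _≈ℂ_ (z w : ℂ) : Set where
  constructor _,≈_
  field
    re≈ : re z ≈ℝ re w
    im≈ : im z ≈ℝ im w
open _≈ℂ_ public

0ℂ 1ℂ : ℂ
re 0ℂ = ιℝ 0ℚ
im 0ℂ = ιℝ 0ℚ
re 1ℂ = ιℝ 1ℚ
im 1ℂ = ιℝ 0ℚ

_+ℂ_ _*ℂ_ : ℂ → ℂ → ℂ
re (z +ℂ w) = re z +ℝ re w
im (z +ℂ w) = im z +ℝ im w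
re (z *ℂ w) = (re z *ℝ re w) +ℝ (-ℝ (im z *ℝ im w))
im (z *ℂ w) = (re z *ℝ im w) +ℝ (im z *ℝ re w)

-ℂ_ : ℂ → ℂ
re (-ℂ z) = -ℝ re z
im (-ℂ z) = -ℝ im z

pointwise⇒≈ℂ : ∀ {z w} → (∀ n → seq (re z) n ≡ seq (re w) n) →
               (∀ n → seq (im z) n ≡ seq (im w) n) → z ≈ℂ w
pointwise⇒≈ℂ p q = pointwise⇒≈ℝ p ,≈ pointwise⇒≈ℝ q

≈ℂ-isEquivalence : IsEquivalence _≈ℂ_
≈ℂ-isEquivalence = record
  { refl  = E.refl ,≈ E.refl
  ; sym   = λ p → E.sym (re≈ p) ,≈ E.sym (im≈ p)
  ; trans = λ p q → E.trans (re≈ p) (re≈ q) ,≈ E.trans (im≈ p) (im≈ q)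
  }
  where module E = IsEquivalence ≈ℝ-isEquivalence

+ℂ-cong : ∀ {z z′ w w′} → z ≈ℂ z′ → w ≈ℂ w′ → z +ℂ w ≈ℂ z′ +ℂ w′
+ℂ-cong p q = +ℝ-cong (re≈ p) (re≈ q) ,≈ +ℝ-cong (im≈ p) (im≈ q)

*ℂ-cong : ∀ {z z′ w w′} → z ≈ℂ z′ → w ≈ℂ w′ → z *ℂ w ≈ℂ z′ *ℂ w′
*ℂ-cong p q =
  +ℝ-cong (*ℝ-cong (re≈ p) (re≈ q)) (-ℝ-cong (*ℝ-cong (im≈ p) (im≈ q))) ,≈
  +ℝ-cong (*ℝ-cong (re≈ p) (im≈ q)) (*ℝ-cong (im≈ p) (re≈ q))

-ℂ-cong : ∀ {z w} → z ≈ℂ w → -ℂ z ≈ℂ -ℂ w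
-ℂ-cong p = -ℝ-cong (re≈ p) ,≈ -ℝ-cong (im≈ p)

module _ where
  open +-*-Solver
  open ℚ-Base using (_+_; _*_; -_)

  +ℂ-assoc : ∀ x y z → (x +ℂ y) +ℂ z ≈ℂ x +ℂ (y +ℂ z)
  +ℂ-assoc x y z = pointwise⇒≈ℂ
    (λ n → re-eq (seq (re x) n) (seq (im x) n) (seq (re y) n) (seq (im y) n) (seq (re z) n) (seq (im z) n))
    (λ n → im-eq (seq (re x) n) (seq (im x) n) (seq (re y) n) (seq (im y) n) (seq (re z) n) (seq (im z) n))
    where
    re-eq : ∀ a b c d e f →
      (a + c) + e ≡
      a + (c + e)
    re-eq = solve 6 (λ a b c d e f →
      (a :+ c) :+ e :=
      a :+ (c :+ e)) refl
    im-eq : ∀ a b c d e f →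
      (b + d) + f ≡
      b + (d + f)
    im-eq = solve 6 (λ a b c d e f →
      (b :+ d) :+ f :=
      b :+ (d :+ f)) refl

  +ℂ-comm : ∀ x y → x +ℂ y ≈ℂ y +ℂ x
  +ℂ-comm x y = pointwise⇒≈ℂ
    (λ n → re-eq (seq (re x) n) (seq (im x) n) (seq (re y) n) (seq (im y) n))
    (λ n → im-eq (seq (re x) n) (seq (im x) n) (seq (re y) n) (seq (im y) n))
    where
    re-eq : ∀ a b c d →
      a + c ≡
      c + a
    re-eq = solve 4 (λ a b c d →
      a :+ c :=
      c :+ a) refl
    im-eq : ∀ a b c d →
      b + d ≡
      d + b
    im-eq = solve 4 (λ a b c d →
      b :+ d :=
      d :+ b) refl

  +ℂ-identityˡ : ∀ x → 0ℂ +ℂ x ≈ℂ x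
  +ℂ-identityˡ x = pointwise⇒≈ℂ
    (λ n → re-eq (seq (re x) n) (seq (im x) n))
    (λ n → im-eq (seq (re x) n) (seq (im x) n))
    where
    re-eq : ∀ a b →
      0ℚ + a ≡
      a
    re-eq = solve 2 (λ a b →
      con 0ℚ :+ a :=
      a) refl
    im-eq : ∀ a b →
      0ℚ + b ≡
      b
    im-eq = solve 2 (λ a b →
      con 0ℚ :+ b :=
      b) refl

  +ℂ-inverseˡ : ∀ x → (-ℂ x) +ℂ x ≈ℂ 0ℂ
  +ℂ-inverseˡ x = pointwise⇒≈ℂ
    (λ n → re-eq (seq (re x) n) (seq (im x) n))
    (λ n → im-eq (seq (re x) n) (seq (im x) n))
    where
    re-eq : ∀ a b →
      (- a) + a ≡
      0ℚ
    re-eq = solve 2 (λ a b →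
      (:- a) :+ a :=
      con 0ℚ) refl
    im-eq : ∀ a b →
      (- b) + b ≡
      0ℚ
    im-eq = solve 2 (λ a b →
      (:- b) :+ b :=
      con 0ℚ) refl

  *ℂ-assoc : ∀ x y z → (x *ℂ y) *ℂ z ≈ℂ x *ℂ (y *ℂ z)
  *ℂ-assoc x y z = pointwise⇒≈ℂ
    (λ n → re-eq (seq (re x) n) (seq (im x) n) (seq (re y) n) (seq (im y) n) (seq (re z) n) (seq (im z) n))
    (λ n → im-eq (seq (re x) n) (seq (im x) n) (seq (re y) n) (seq (im y) n) (seq (re z) n) (seq (im z) n))
    where
    re-eq : ∀ a b c d e f →
      (((a * c) + (- (b * d))) * e) + (- (((a * d) + (b * c)) * f)) ≡
      (a * ((c * e) + (- (d * f)))) + (- (b * ((c * f) + (d * e))))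
    re-eq = solve 6 (λ a b c d e f →
      (((a :* c) :+ (:- (b :* d))) :* e) :+ (:- (((a :* d) :+ (b :* c)) :* f)) :=
      (a :* ((c :* e) :+ (:- (d :* f)))) :+ (:- (b :* ((c :* f) :+ (d :* e))))) refl
    im-eq : ∀ a b c d e f →
      (((a * c) + (- (b * d))) * f) + (((a * d) + (b * c)) * e) ≡
      (a * ((c * f) + (d * e))) + (b * ((c * e) + (- (d * f))))
    im-eq = solve 6 (λ a b c d e f →
      (((a :* c) :+ (:- (b :* d))) :* f) :+ (((a :* d) :+ (b :* c)) :* e) :=
      (a :* ((c :* f) :+ (d :* e))) :+ (b :* ((c :* e) :+ (:- (d :* f))))) refl

  *ℂ-comm : ∀ x y → x *ℂ y ≈ℂ y *ℂ x
  *ℂ-comm x y = pointwise⇒≈ℂ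
    (λ n → re-eq (seq (re x) n) (seq (im x) n) (seq (re y) n) (seq (im y) n))
    (λ n → im-eq (seq (re x) n) (seq (im x) n) (seq (re y) n) (seq (im y) n))
    where
    re-eq : ∀ a b c d →
      (a * c) + (- (b * d)) ≡
      (c * a) + (- (d * b))
    re-eq = solve 4 (λ a b c d →
      (a :* c) :+ (:- (b :* d)) :=
      (c :* a) :+ (:- (d :* b))) refl
    im-eq : ∀ a b c d →
      (a * d) + (b * c) ≡
      (c * b) + (d * a)
    im-eq = solve 4 (λ a b c d →
      (a :* d) :+ (b :* c) :=
      (c :* b) :+ (d :* a)) refl

  *ℂ-identityˡ : ∀ x → 1ℂ *ℂ x ≈ℂ x
  *ℂ-identityˡ x = pointwise⇒≈ℂ
    (λ n → re-eq (seq (re x) n) (seq (im x) n))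
    (λ n → im-eq (seq (re x) n) (seq (im x) n))
    where
    re-eq : ∀ a b →
      (1ℚ * a) + (- (0ℚ * b)) ≡
      a
    re-eq = solve 2 (λ a b →
      (con 1ℚ :* a) :+ (:- (con 0ℚ :* b)) :=
      a) refl
    im-eq : ∀ a b →
      (1ℚ * b) + (0ℚ * a) ≡
      b
    im-eq = solve 2 (λ a b →
      (con 1ℚ :* b) :+ (con 0ℚ :* a) :=
      b) refl

  *ℂ-distribʳ : ∀ x y z → (y +ℂ z) *ℂ x ≈ℂ (y *ℂ x) +ℂ (z *ℂ x)
  *ℂ-distribʳ x y z = pointwise⇒≈ℂ
    (λ n → re-eq (seq (re x) n) (seq (im x) n) (seq (re y) n) (seq (im y) n) (seq (re z) n) (seq (im z) n))
    (λ n → im-eq (seq (re x) n) (seq (im x) n) (seq (re y) n) (seq (im y) n) (seq (re z) n) (seq (im z) n))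
    where
    re-eq : ∀ a b c d e f →
      ((c + e) * a) + (- ((d + f) * b)) ≡
      ((c * a) + (- (d * b))) + ((e * a) + (- (f * b)))
    re-eq = solve 6 (λ a b c d e f →
      ((c :+ e) :* a) :+ (:- ((d :+ f) :* b)) :=
      ((c :* a) :+ (:- (d :* b))) :+ ((e :* a) :+ (:- (f :* b)))) refl
    im-eq : ∀ a b c d e f →
      ((c + e) * b) + ((d + f) * a) ≡
      ((c * b) + (d * a)) + ((e * b) + (f * a))
    im-eq = solve 6 (λ a b c d e f →
      ((c :+ e) :* b) :+ ((d :+ f) :* a) :=
      ((c :* b) :+ (d :* a)) :+ ((e :* b) :+ (f :* a))) refl

ℂ-setoid : Setoid 0ℓ 0ℓ
ℂ-setoid = record { isEquivalence = ≈ℂ-isEquivalence }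

ℂ-commutativeRing : CommutativeRing 0ℓ 0ℓ
ℂ-commutativeRing = record
  { Carrier = ℂ ; _≈_ = _≈ℂ_ ; _+_ = _+ℂ_ ; _*_ = _*ℂ_ ; -_ = -ℂ_ ; 0# = 0ℂ ; 1# = 1ℂ
  ; isCommutativeRing = record
    { isRing = record
      { +-isAbelianGroup = record
        { isGroup = record
          { isMonoid = record
            { isSemigroup = record
              { isMagma = record
                { isEquivalence = ≈ℂ-isEquivalence ; ∙-cong = +ℂ-cong }
              ; assoc = +ℂ-assoc
              }
            ; identity = comm∧idˡ⇒id +ℂ-comm +ℂ-identityˡ
            }
          ; inverse = comm∧invˡ⇒inv +ℂ-comm +ℂ-inverseˡ
          ; ⁻¹-cong = -ℂ-cong
          }
        ; comm = +ℂ-comm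
        }
      ; *-cong = *ℂ-cong
      ; *-assoc = *ℂ-assoc
      ; *-identity = comm∧idˡ⇒id *ℂ-comm *ℂ-identityˡ
      ; distrib = comm∧distrʳ⇒distr +ℂ-cong *ℂ-comm *ℂ-distribʳ
      }
    ; *-comm = *ℂ-comm
    }
  }
  where
  open import Algebra.Consequences.Setoid ℂ-setoid

open CommutativeRing ℂ-commutativeRing using (+-monoid; *-monoid)
open import Algebra.Properties.Monoid.Sum +-monoid public using () renaming (sum to ∑)
open import Algebra.Properties.Monoid.Sum *-monoid public using () renaming (sum to ∏)

-- Labels of the product basis of ⊗ᵢ ℂ^(c i)
Index : ∀ {n} → (Fin n → ℕ) → Set
Index c = All Fin (tabulate c)

-- ⊗ᵢ ℂ^(c i), by coordinates with respect to the product basis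
Tensor : ∀ {n} → (Fin n → ℕ) → Set
Tensor c = Index c → ℂ

∑All : ∀ {n} {cs : Vec ℕ n} → (All Fin cs → ℂ) → ℂ
∑All {cs = []}     f = f []
∑All {cs = c ∷ cs} f = ∑ λ i → ∑All λ is → f (i ∷ is)

∑Index : ∀ {n} (c : Fin n → ℕ) → (Index c → ℂ) → ℂ
∑Index c = ∑All

module _ {X : Set} where

  infix 4 _≋_

  _≋_ : (X → ℂ) → (X → ℂ) → Set
  v ≋ w = ∀ x → v x ≈ℂ w x

  combination : ∀ {r} → (Fin r → ℂ) → (Fin r → X → ℂ) → X → ℂ
  combination a b x = ∑ λ i → a i *ℂ b i x

  LinearlyIndependent : ∀ {r} → (Fin r → X → ℂ) → Set
  LinearlyIndependent b = ∀ a → combination a b ≋ (λ _ → 0ℂ) → ∀ i → a i ≈ℂ 0ℂ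

  -- The subspace P of X → ℂ has a basis with r elements
  HasDimension : ((X → ℂ) → Set) → ℕ → Set
  HasDimension P r = Σ (Fin r → X → ℂ) λ b →
    (∀ i → P (b i)) ×
    LinearlyIndependent b ×
    (∀ v → P v → ∃ λ a → v ≋ combination a b)

-- Hom(⊗ᵢ ℂ^(c i) , ⊗ⱼ ℂ^(c′ j)), by matrix entries ⟨J|M|I⟩ = M J I
Hom : ∀ {m n} → (Fin m → ℕ) → (Fin n → ℕ) → Set
Hom c c′ = Index c′ → Index c → ℂ

module _ {m n} {c : Fin m → ℕ} {c′ : Fin n → ℕ} where

  apply : Hom c c′ → Tensor c → Tensor c′
  apply M v J = ∑Index c λ I → M J I *ℂ v I

  InImage : Hom c c′ → Tensor c′ → Set
  InImage M w = ∃ λ v → w ≋ apply M v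

  HasRank : Hom c c′ → ℕ → Set
  HasRank M = HasDimension (InImage M)

data Node (#S #T #V : ℕ) : Set where
  input  : Fin #S → Node #S #T #V
  output : Fin #T → Node #S #T #V
  vertex : Fin #V → Node #S #T #V

record Template : Set where
  field
    #S #T #V #E : ℕ

  -- Edge e has the two ends (e , 0F) and (e , 1F).  Which of them is called
  -- 0F is immaterial.  Multiple edges and loops at vertices are possible.
  EdgeEnd : Set
  EdgeEnd = Fin #E × Fin 2

  field
    endpoint   : EdgeEnd → Node #S #T #V
    inputEnd   : ∀ u → ∃! _≡_ λ h → endpoint h ≡ input u
    outputEnd  : ∀ u → ∃! _≡_ λ h → endpoint h ≡ output u
    degree     : Fin #V → ℕ
    ordering   : ∀ v → Fin (degree v) ↔ ∃ λ h → endpoint h ≡ vertex v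
    capacity   : Fin #E → ℕ
    capacity>0 : ∀ e → 0 ℕ.< capacity e

  inputEdge : Fin #S → Fin #E
  inputEdge u = proj₁ (proj₁ (inputEnd u))

  outputEdge : Fin #T → Fin #E
  outputEdge u = proj₁ (proj₁ (outputEnd u))

  edgeAt : ∀ v → Fin (degree v) → Fin #E
  edgeAt v i = proj₁ (proj₁ (Inverse.to (ordering v) i))

module _ (G : Template) where
  open Template G

  TensorAssignment : Set
  TensorAssignment = ∀ v → Tensor (capacity ∘ edgeAt v)

  restrict : ∀ {k} (e : Fin k → Fin #E) → Index capacity → Index (capacity ∘ e)
  restrict e W = tabulate⁺ λ i → tabulate⁻ W (e i)

  Agree : ∀ {k} (e : Fin k → Fin #E) → Index capacity → Index (capacity ∘ e) → Set
  Agree e W I = ∀ u → tabulate⁻ W (e u) ≡ tabulate⁻ {f = capacity ∘ e} I u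

  agree? : ∀ {k} (e : Fin k → Fin #E) W I → Dec (Agree e W I)
  agree? e W I = all? λ u → tabulate⁻ W (e u) ≟ᶠ tabulate⁻ {f = capacity ∘ e} I u

  β : TensorAssignment → Hom (capacity ∘ inputEdge) (capacity ∘ outputEdge)
  β 𝒯 I-T I-S = ∑Index capacity λ W →
    if does (agree? inputEdge W I-S ×-dec agree? outputEdge W I-T)
    then ∏ (λ v → 𝒯 v (restrict (edgeAt v) W))
    else 0ℂ

  -- n = QMF(G,c), the maximum of the ranks of the β 𝒯.  A relation rather than
  -- a function, because the rank of a matrix over ℂ cannot be computed.
  IsQMF : ℕ → Set
  IsQMF n = (∃ λ 𝒯 → HasRank (β 𝒯) n) × (∀ 𝒯 r → HasRank (β 𝒯) r → r ℕ.≤ n)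

  -- S̄ is where side is true, T̄ is where it is false
  IsEdgeCutSet : Subset #E → Set
  IsEdgeCutSet C = ∃ λ (side : Node #S #T #V → Bool) →
    (∀ u → side (input u) ≡ true) ×
    (∀ u → side (output u) ≡ false) ×
    (∀ e → e ∈ C ⇔ side (endpoint (e , 0F)) ≢ side (endpoint (e , 1F)))

  cutCapacity : Subset #E → ℕ
  cutCapacity C = product (map capacity (filter (_∈? C) (allFin #E)))

  -- n = QMC(G,c)
  IsQMC : ℕ → Set
  IsQMC n = (∃ λ C → IsEdgeCutSet C × cutCapacity C ≡ n) ×
            (∀ C → IsEdgeCutSet C → n ℕ.≤ cutCapacity C)

{-# OPTIONS --safe #-}
module Submission where

-- Split every edge of capacity d^m into m strands of dimension d, and call two strands adjacent when they
-- meet at a common vertex.  By Menger's theorem there are k disjoint walks of strands from the inputs to the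
-- outputs, and at most k strands separating the inputs from the outputs.  Let every tensor force the strands
-- of a walk to carry the same digit, and all other strands to carry 0: then β is a sum of d^k rank-one
-- matrices, one for each word of digits on the walks, which are independent, so β has rank d^k.  The
-- separating strands yield an edge cut set of capacity at most d^k.  Conversely, β factors through every
-- edge cut set, so its rank is at most the capacity; this also shows that the edge cut set found is minimal.

-- Equality in ℂ is undecidable here, so pivots cannot be chosen and a rank cannot be computed. An
-- upper bound is therefore stated as a decomposition into `s` outer products, and `r > s`
-- independent vectors in the image are shown to force `1ℂ ≈ℂ 0ℂ`. Division is replaced by
-- reducedness: in ℂ, z² = 0 implies z = 0. In Menger's theorem the strands, not the vertices of
-- `G`, are the points. Disjoint walks share no strand but may pass through the same vertex, whose
-- single tensor then serves all of them. The delicate case is an edge that joins an input directly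
-- to an output. No tensor acts on it, so its index is transmitted under every assignment. All its
-- strands must therefore lie on walks, which comparing the number of walks with the size of the
-- separator guarantees.

open import Defs
open import Level using (0ℓ)
open import Algebra.Bundles using (CommutativeRing)
import Algebra.Properties.CommutativeMonoid.Sum
import Algebra.Properties.Ring
import Algebra.Properties.Semiring.Sum
import Algebra.Solver.Ring.NaturalCoefficients.Default as SemiringSolver
open import Data.Bool.Base using (Bool; true; false; if_then_else_)
import Data.Bool.Properties as Bool
open import Data.Fin.Base
  using (Fin; zero; suc; fromℕ<; inject≤; punchIn; punchOut; cast; combine; finToFun; funToFin)
open import Data.Fin.Patterns using (0F; 1F)
open import Data.Fin.Properties as Fin
  using (any?; all?; injective⇒≤; punchOut-injective; inject≤-injective; cast-involutive;
         finToFun-funToFin; funToFin-finToFin)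
open import Data.Fin.Subset as Subset using (Subset)
import Data.Fin.Subset.Properties as Subset
open import Data.List.Base as List using (List; []; _∷_; _++_; length; allFin)
open import Data.List.Membership.Propositional using (_∈_)
open import Data.List.Membership.Propositional.Properties
  using (∈-filter⁺; ∈-filter⁻; ∈-lookup; ∈-++⁺ˡ; ∈-++⁺ʳ; ∈-++⁻; ∈-map⁺; ∈-map⁻; ∈-allFin; ∈-cartesianProduct⁺)
open import Data.List.Properties using (length-++; length-map; length-tabulate)
import Data.List.Relation.Unary.All as ListAll
open import Data.List.Relation.Unary.AllPairs using ([]; _∷_)
open import Data.List.Relation.Unary.Any using (here; there; index)
open import Data.List.Relation.Unary.Any.Properties using (lookup-index)
open import Data.List.Relation.Unary.Unique.Propositional using (Unique)
import Data.List.Relation.Unary.Unique.Propositional.Properties as Unique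
open import Data.Nat.Base as ℕ using (ℕ; zero; suc; _≤_; _<_; _^_)
open import Data.Nat.ListAction using (product)
import Data.Nat.Properties as ℕ
open import Data.Product.Base using (Σ; ∃; ∃₂; _×_; _,_; proj₁; proj₂)
open import Data.Product.Properties using (≡-dec)
open import Data.Rational.Base as ℚ using (0ℚ; 1ℚ; ½)
import Data.Rational.Properties as ℚ
import Data.Rational.Solver as ℚ-Solver
open import Data.Sum.Base as Sum using (_⊎_; inj₁; inj₂; [_,_]′)
open import Data.Vec.Base as Vec using (Vec; []; _∷_)
import Data.Vec.Functional as V
import Data.Vec.Functional.Properties as V
import Data.Vec.Properties as Vec
open import Data.Vec.Relation.Unary.All using (All; []; _∷_)
open import Data.Vec.Relation.Unary.All.Properties using (tabulate⁺; tabulate⁻)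
open import Function.Base using (_∘_; id; case_of_)
open import Function.Bundles using (_⇔_; mk⇔; Equivalence; Inverse)
open import Relation.Binary.Construct.Closure.ReflexiveTransitive as RTC using (Star; _◅_; _◅◅_)
open import Relation.Binary.Core using (Rel; _⇒_)
open import Relation.Binary.Definitions using (DecidableEquality)
open import Relation.Binary.PropositionalEquality as ≡ using (_≡_; _≢_)
open import Relation.Binary.Structures using (IsEquivalence)
open import Relation.Nullary using (Dec; yes; no; ¬_; contradiction; does)
open import Relation.Nullary.Decidable
  using (_×-dec_; _⊎-dec_; _→-dec_; ¬?; dec-true; dec-false; does-⇔)
open import Relation.Unary using (Decidable)

-- Menger's theorem

module Menger where

  open ≡ using (refl; sym; trans; cong; subst)
  open RTC using (ε)

  infix 4 _∈ᶠ_

  _∈ᶠ_ : ∀ {X : Set} {n} → X → (Fin n → X) → Set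
  x ∈ᶠ f = ∃ λ i → f i ≡ x

  injective⇒surjective : ∀ {n} {f : Fin n → Fin n} → (∀ {i j} → f i ≡ f j → i ≡ j) → ∀ j → j ∈ᶠ f
  injective⇒surjective {suc n} {f} inj j with any? (λ i → f i Fin.≟ j)
  ... | yes j∈f = j∈f
  ... | no j∉f = contradiction
    (injective⇒≤ {f = λ i → punchOut (avoid i)} (inj ∘ punchOut-injective (avoid _) (avoid _)))
    ℕ.1+n≰n
    where
    avoid : ∀ i → j ≢ f i
    avoid i eq = j∉f (i , sym eq)

  -- The x i containing their marks are disjoint, so distinct i have distinct types; by the pigeonhole principle
  -- every type occurs.
  reindex : ∀ {V : Set} {n k} → n ≤ k → (X : Fin n → Set) (_∈ˣ_ : ∀ {t} → V → X t → Set)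
            (mark : Fin n → V) → (∀ {t} (x : X t) → mark t ∈ˣ x) →
            (x : Fin k → ∃ X) → (∀ {i j v} → v ∈ˣ proj₂ (x i) → v ∈ˣ proj₂ (x j) → i ≡ j) →
            Σ (∀ t → X t) λ y → ∀ {t t′ v} → v ∈ˣ y t → v ∈ˣ y t′ → t ≡ t′
  reindex {V} {n} n≤k X _∈ˣ_ mark mark∈ x disjoint = (λ t → proj₁ (y t)) , λ {t} {t′} → y-disjoint t t′
    where
    x′ : Fin n → ∃ X
    x′ i = x (inject≤ i n≤k)
    disjoint′ : ∀ i j {v} → v ∈ˣ proj₂ (x′ i) → v ∈ˣ proj₂ (x′ j) → i ≡ j
    disjoint′ i j v∈ v∈′ = inject≤-injective n≤k n≤k i j (disjoint v∈ v∈′)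
    τ : Fin n → Fin n
    τ = proj₁ ∘ x′
    τ-injective : ∀ {i j} → τ i ≡ τ j → i ≡ j
    τ-injective {i} {j} eq = disjoint′ i j (mark∈ _) (subst (λ t → mark t ∈ˣ proj₂ (x′ j)) (sym eq) (mark∈ _))
    At : ∀ t → X t → Set
    At t y = ∃ λ i → τ i ≡ t × (∀ {v} → v ∈ˣ y → v ∈ˣ proj₂ (x′ i))
    at : ∀ {t} i → τ i ≡ t → Σ (X t) (At t)
    at i refl = proj₂ (x′ i) , i , refl , id
    y : ∀ t → Σ (X t) (At t)
    y t = let i , τi≡t = injective⇒surjective τ-injective t in at i τi≡t
    y-disjoint : ∀ t t′ {v} → v ∈ˣ proj₁ (y t) → v ∈ˣ proj₁ (y t′) → t ≡ t′
    y-disjoint t t′ v∈ v∈′ with y t | y t′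
    ... | _ , i , refl , ⊆i | _ , j , refl , ⊆j = cong τ (disjoint′ i j (⊆i v∈) (⊆j v∈′))

  lookup-injective : ∀ {X : Set} {xs : List X} → Unique xs → ∀ {i j} →
                     List.lookup xs i ≡ List.lookup xs j → i ≡ j
  lookup-injective (_ ∷ _) {zero} {zero} _ = refl
  lookup-injective {xs = _ ∷ xs} (x≢ ∷ _) {zero} {suc j} eq = contradiction eq (ListAll.lookup x≢ (∈-lookup j))
  lookup-injective {xs = _ ∷ xs} (x≢ ∷ _) {suc i} {zero} eq = contradiction (sym eq) (ListAll.lookup x≢ (∈-lookup i))
  lookup-injective (_ ∷ u) {suc i} {suc j} eq = cong suc (lookup-injective u eq)

  module _ {V : Set} where

    module _ {E : Rel V 0ℓ} where

      infix 4 _∈ʷ_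

      _∈ʷ_ : ∀ {u v} → V → Star E u v → Set
      x ∈ʷ ε {u}       = x ≡ u
      x ∈ʷ _◅_ {u} _ p = x ≡ u ⊎ x ∈ʷ p

    infix 4 _⊆ʷ_

    _⊆ʷ_ : ∀ {E F : Rel V 0ℓ} {u v s t} → Star E u v → Star F s t → Set
    p ⊆ʷ q = ∀ {x} → x ∈ʷ p → x ∈ʷ q

    start∈ : ∀ {E : Rel V 0ℓ} {u v} (p : Star E u v) → u ∈ʷ p
    start∈ ε       = refl
    start∈ (_ ◅ _) = inj₁ refl

    end∈ : ∀ {E : Rel V 0ℓ} {u v} (p : Star E u v) → v ∈ʷ p
    end∈ ε       = refl
    end∈ (_ ◅ p) = inj₂ (end∈ p)

    ∈ʷ-◅◅⁻ : ∀ {E : Rel V 0ℓ} {x u v w} (p : Star E u v) {q : Star E v w} →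
            x ∈ʷ p ◅◅ q → x ∈ʷ p ⊎ x ∈ʷ q
    ∈ʷ-◅◅⁻ ε       x∈        = inj₂ x∈
    ∈ʷ-◅◅⁻ (_ ◅ p) (inj₁ eq) = inj₁ (inj₁ eq)
    ∈ʷ-◅◅⁻ (_ ◅ p) (inj₂ x∈) = Sum.map₁ inj₂ (∈ʷ-◅◅⁻ p x∈)

    ∈ʷ-map⁻ : ∀ {E F : Rel V 0ℓ} {f : E ⇒ F} {u v} (p : Star E u v) → RTC.map f p ⊆ʷ p
    ∈ʷ-map⁻ ε       eq = eq
    ∈ʷ-map⁻ (_ ◅ p) = Sum.map₂ (∈ʷ-map⁻ p)

    prefix : ∀ {E : Rel V 0ℓ} {u v x} (p : Star E u v) → x ∈ʷ p → Σ (Star E u x) (_⊆ʷ p)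
    prefix ε       refl        = ε , id
    prefix (_ ◅ _) (inj₁ refl) = ε , inj₁
    prefix (e ◅ p) (inj₂ x∈)   = let q , q⊆p = prefix p x∈ in e ◅ q , Sum.map₂ q⊆p

    suffix : ∀ {E : Rel V 0ℓ} {u v x} (p : Star E u v) → x ∈ʷ p → Σ (Star E x v) (_⊆ʷ p)
    suffix ε       refl        = ε , id
    suffix (e ◅ p) (inj₁ refl) = e ◅ p , id
    suffix (_ ◅ p) (inj₂ x∈)   = let q , q⊆p = suffix p x∈ in q , inj₂ ∘ q⊆p

    -- A walk of `Before P` steps can meet `P` only at its end, a walk of `After P` steps only at
    -- its start; encoding this in the edge relation keeps it available for every part of the walk.
    Before After : (V → Set) → Rel V 0ℓ → Rel V 0ℓ
    Before P E u v = ¬ P u × E u v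
    After  P E u v = E u v × ¬ P v

    Before-end : ∀ {P E x u v} (p : Star (Before P E) u v) → x ∈ʷ p → P x → x ≡ v
    Before-end ε             eq          _  = eq
    Before-end ((¬Pu , _) ◅ _) (inj₁ refl) Px = contradiction Px ¬Pu
    Before-end (_ ◅ p)       (inj₂ x∈)   Px = Before-end p x∈ Px

    After-start : ∀ {P E x u v} (p : Star (After P E) u v) → x ∈ʷ p → P x → x ≡ u
    After-start ε       eq        _  = eq
    After-start (_ ◅ _) (inj₁ eq) _  = eq
    After-start {P} ((_ , ¬Pw) ◅ p) (inj₂ x∈) Px = contradiction (subst P (After-start p x∈ Px) Px) ¬Pw

    firstHit : ∀ {P E u v} → Decidable P → (p : Star E u v) → P v →
               ∃ λ w → P w × Σ (Star (Before P E) u w) (_⊆ʷ p)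
    firstHit {u = u} P? p Pv with P? u
    ... | yes Pu = u , Pu , ε , λ { refl → start∈ p }
    firstHit P? ε       Pv | no ¬Pu = contradiction Pv ¬Pu
    firstHit P? (e ◅ p) Pv | no ¬Pu =
      let w , Pw , q , q⊆p = firstHit P? p Pv in w , Pw , (¬Pu , e) ◅ q , Sum.map₂ q⊆p

    lastHit : ∀ {P E u v} → Decidable P → (p : Star E u v) → P u →
              ∃ λ w → P w × Σ (Star (After P E) w v) (_⊆ʷ p)
    lastHit {P} {E} P? p Pu = [ id , (λ (¬Pu , _) → contradiction Pu ¬Pu) ]′ (go p)
      where
      -- The second alternative says that the whole walk avoids `P`; only then may the edge in front
      -- of it become an `After` step out of a vertex of `P`.
      go : ∀ {u v} (p : Star E u v) →
           (∃ λ w → P w × Σ (Star (After P E) w v) (_⊆ʷ p)) ⊎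
           (¬ P u × Σ (Star (After P E) u v) (_⊆ʷ p))
      go {u} ε with P? u
      ... | yes Pu = inj₁ (u , Pu , ε , id)
      ... | no ¬Pu = inj₂ (¬Pu , ε , id)
      go {u} (e ◅ p) with go p
      ... | inj₁ (w , Pw , q , q⊆p) = inj₁ (w , Pw , q , inj₂ ∘ q⊆p)
      ... | inj₂ (¬Pv , q , q⊆p) with P? u
      ...   | yes Pu = inj₁ (u , Pu , (e , ¬Pv) ◅ q , Sum.map₂ q⊆p)
      ...   | no ¬Pu = inj₂ (¬Pu , (e , ¬Pv) ◅ q , Sum.map₂ q⊆p)

    record Linkage (E : Rel V 0ℓ) (A B : V → Set) (k : ℕ) : Set where
      field
        {start end} : Fin k → V
        walk        : ∀ i → Star E (start i) (end i)
        start-A     : ∀ i → A (start i)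
        end-B       : ∀ i → B (end i)
        disjoint    : ∀ {i j x} → x ∈ʷ walk i → x ∈ʷ walk j → i ≡ j

    mapLinkage : ∀ {E F A B k} → E ⇒ F → Linkage E A B k → Linkage F A B k
    mapLinkage f l = record
      { walk = RTC.map f ∘ walk ; start-A = start-A ; end-B = end-B
      ; disjoint = λ x∈ x∈′ → disjoint (∈ʷ-map⁻ (walk _) x∈) (∈ʷ-map⁻ (walk _) x∈′) }
      where open Linkage l

    -- Reached overapproximates the set of vertices that can be reached from A without meeting the cut;
    -- it certifies that the cut separates A from B.
    record Separator (E : Rel V 0ℓ) (A B : V → Set) (m : ℕ) : Set₁ where
      field
        cut      : Fin m → V
        Reached  : V → Set
        reached? : Decidable Reached
        source   : ∀ {v} → A v → v ∈ᶠ cut ⊎ Reached v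
        step     : ∀ {u v} → Reached u → E u v → v ∈ᶠ cut ⊎ Reached v
        target   : ∀ {v} → Reached v → ¬ B v

      crossing : ∀ {u v} → A u → B v → (p : Star E u v) → ∃ λ x → x ∈ʷ p × x ∈ᶠ cut
      crossing Au Bv p = go (source Au) Bv p
        where
        go : ∀ {u v} → u ∈ᶠ cut ⊎ Reached u → B v → (p : Star E u v) → ∃ λ x → x ∈ʷ p × x ∈ᶠ cut
        go (inj₁ u∈) _ p             = _ , start∈ p , u∈
        go (inj₂ Ru) Bv ε       = contradiction Bv (target Ru)
        go (inj₂ Ru) Bv (e ◅ p) = let x , x∈ , x∈cut = go (step Ru e) Bv p in x , inj₂ x∈ , x∈cut

    mapSeparator : ∀ {E F A B m} → E ⇒ F → Separator F A B m → Separator E A B m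
    mapSeparator f s = record
      { cut = cut ; Reached = Reached ; reached? = reached? ; source = source
      ; step = λ Ru e → step Ru (f e) ; target = target }
      where open Separator s

    module _ {E : Rel V 0ℓ} {A B : V → Set} {k m} (m≤k : m ≤ k)
             (l : Linkage E A B k) (s : Separator E A B m) where
      open Linkage l
      open Separator s

      -- Otherwise the walks and the vertex itself would meet the cut in k + 1 > m distinct vertices.
      source∩target-linked : (∈walk? : ∀ x i → Dec (x ∈ʷ walk i)) → ∀ {x} → A x → B x → ∃ λ i → x ∈ʷ walk i
      source∩target-linked ∈walk? {x} Ax Bx with any? (∈walk? x) | source Ax
      ... | yes x∈ | _ = x∈
      ... | no x∉ | inj₂ Rx = contradiction Bx (target Rx)
      ... | no x∉ | inj₁ (c , cutc≡x) = contradiction (ℕ.≤-trans (injective⇒≤ {f = f} f-injective) m≤k) ℕ.1+n≰n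
        where
        hit : ∀ i → ∃ λ y → y ∈ʷ walk i × y ∈ᶠ cut
        hit i = crossing (start-A i) (end-B i) (walk i)
        f : Fin (suc k) → Fin m
        f zero    = c
        f (suc i) = proj₁ (proj₂ (proj₂ (hit i)))
        cut-f∈ : ∀ i → cut (f (suc i)) ∈ʷ walk i
        cut-f∈ i = subst (_∈ʷ walk i) (sym (proj₂ (proj₂ (proj₂ (hit i))))) (proj₁ (proj₂ (hit i)))
        f≢c : ∀ i → f (suc i) ≢ c
        f≢c i eq = x∉ (i , subst (_∈ʷ walk i) (trans (cong cut eq) cutc≡x) (cut-f∈ i))
        f-injective : ∀ {i j} → f i ≡ f j → i ≡ j
        f-injective {zero}  {zero}  _  = refl
        f-injective {zero}  {suc j} eq = contradiction (sym eq) (f≢c j)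
        f-injective {suc i} {zero}  eq = contradiction eq (f≢c i)
        f-injective {suc i} {suc j} eq = cong suc
          (disjoint (subst (λ c → cut c ∈ʷ walk i) eq (cut-f∈ i)) (cut-f∈ j))

  module _ {V : Set} (_≟_ : DecidableEquality V) where

    _∈ᶠ?_ : ∀ {n} (x : V) (f : Fin n → V) → Dec (x ∈ᶠ f)
    x ∈ᶠ? f = any? λ i → f i ≟ x

    _∈ʷ?_ : ∀ {E : Rel V 0ℓ} {u v} (x : V) (p : Star E u v) → Dec (x ∈ʷ p)
    x ∈ʷ? ε {u}       = x ≟ u
    x ∈ʷ? _◅_ {u} _ p = (x ≟ u) ⊎-dec (x ∈ʷ? p)

    -- Indexed by the entries of `P` instead of by an arbitrary `Fin k`, so that walks into and
    -- walks out of a cut can be matched entry by entry.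
    WalksInto : Rel V 0ℓ → (V → Set) → ∀ {n} → (Fin n → V) → Set
    WalksInto E A P =
      Σ (∀ t → ∃ λ u → A u × Star (Before (_∈ᶠ P) E) u (P t)) λ w →
        ∀ {t t′ x} → x ∈ʷ proj₂ (proj₂ (w t)) → x ∈ʷ proj₂ (proj₂ (w t′)) → t ≡ t′

    WalksFrom : Rel V 0ℓ → ∀ {n} → (Fin n → V) → (V → Set) → Set
    WalksFrom E Q B =
      Σ (∀ t → ∃ λ v → B v × Star (After (_∈ᶠ Q) E) (Q t) v) λ w →
        ∀ {t t′ x} → x ∈ʷ proj₂ (proj₂ (w t)) → x ∈ʷ proj₂ (proj₂ (w t′)) → t ≡ t′

    -- Each walk is cut off at its first vertex in `P`. The ends of the trimmed walks are distinct
    -- because the walks are disjoint, and there are enough walks to use up all of `P`.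
    reachEvery : ∀ {E A n k} (P : Fin n → V) → n ≤ k → Linkage E A (_∈ᶠ P) k → WalksInto E A P
    reachEvery {E} {A} {n} {k} P n≤k l =
      reindex n≤k (λ t → ∃ λ u → A u × Star (Before (_∈ᶠ P) E) u (P t)) (λ v x → v ∈ʷ proj₂ (proj₂ x)) P
        (λ x → end∈ (proj₂ (proj₂ x))) (proj₁ ∘ trimmed)
        (λ {i} {j} x∈ x∈′ → disjoint (proj₂ (trimmed i) x∈) (proj₂ (trimmed j) x∈′))
      where
      open Linkage l
      trimmed : ∀ i → Σ (∃ λ t → ∃ λ u → A u × Star (Before (_∈ᶠ P) E) u (P t))
                        λ x → proj₂ (proj₂ (proj₂ x)) ⊆ʷ walk i
      trimmed i with firstHit (_∈ᶠ? P) (walk i) (end-B i)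
      ... | _ , (t , refl) , q , q⊆ = (t , _ , start-A i , q) , q⊆

    leaveEvery : ∀ {E B n k} (Q : Fin n → V) → n ≤ k → Linkage E (_∈ᶠ Q) B k → WalksFrom E Q B
    leaveEvery {E} {B} {n} {k} Q n≤k l =
      reindex n≤k (λ t → ∃ λ v → B v × Star (After (_∈ᶠ Q) E) (Q t) v) (λ v x → v ∈ʷ proj₂ (proj₂ x)) Q
        (λ x → start∈ (proj₂ (proj₂ x))) (proj₁ ∘ trimmed)
        (λ {i} {j} x∈ x∈′ → disjoint (proj₂ (trimmed i) x∈) (proj₂ (trimmed j) x∈′))
      where
      open Linkage l
      trimmed : ∀ i → Σ (∃ λ t → ∃ λ v → B v × Star (After (_∈ᶠ Q) E) (Q t) v)
                        λ x → proj₂ (proj₂ (proj₂ x)) ⊆ʷ walk i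
      trimmed i with lastHit (_∈ᶠ? Q) (walk i) (start-A i)
      ... | _ , (t , refl) , q , q⊆ = (t , _ , end-B i , q) , q⊆

    module _ {E F : Rel V 0ℓ} (E⊆F : E ⇒ F) {A B : V → Set} {m} (s : Separator E A B m) where
      open Separator s

      -- At an entry of `cut` the two walks are glued at their common vertex; at the extra entry
      -- `zero` the new edge from `x` to `y` bridges the gap. Disjointness holds because in the old
      -- graph the two families can meet only in `cut`.
      join : ∀ {x y} → F x y → WalksInto E A (x V.∷ cut) → WalksFrom E (y V.∷ cut) B → Linkage F A B (suc m)
      join {x} {y} e (p , p-disjoint) (q , q-disjoint) = record
        { walk = walk ; start-A = λ t → proj₁ (proj₂ (p t)) ; end-B = λ t → proj₁ (proj₂ (q t))
        ; disjoint = λ {t} {t′} x∈ x∈′ → disjoint (walk-∈ t x∈) (walk-∈ t′ x∈′) }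
        where
        P = x V.∷ cut
        Q = y V.∷ cut
        pʷ : ∀ t → Star (Before (_∈ᶠ P) E) (proj₁ (p t)) (P t)
        pʷ t = proj₂ (proj₂ (p t))
        qʷ : ∀ t → Star (After (_∈ᶠ Q) E) (Q t) (proj₁ (q t))
        qʷ t = proj₂ (proj₂ (q t))
        pF : ∀ t → Star F (proj₁ (p t)) (P t)
        pF t = RTC.map (E⊆F ∘ proj₂) (pʷ t)
        qF : ∀ t → Star F (Q t) (proj₁ (q t))
        qF t = RTC.map (E⊆F ∘ proj₁) (qʷ t)
        walk : ∀ t → Star F (proj₁ (p t)) (proj₁ (q t))
        walk zero    = pF zero ◅◅ e ◅ qF zero
        walk (suc t) = pF (suc t) ◅◅ qF (suc t)
        walk-∈ : ∀ t {z} → z ∈ʷ walk t → z ∈ʷ pʷ t ⊎ z ∈ʷ qʷ t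
        walk-∈ zero z∈ with ∈ʷ-◅◅⁻ (pF zero) z∈
        ... | inj₁ z∈p         = inj₁ (∈ʷ-map⁻ (pʷ zero) z∈p)
        ... | inj₂ (inj₁ refl) = inj₁ (end∈ (pʷ zero))
        ... | inj₂ (inj₂ z∈q)  = inj₂ (∈ʷ-map⁻ (qʷ zero) z∈q)
        walk-∈ (suc t) z∈ = Sum.map (∈ʷ-map⁻ (pʷ (suc t))) (∈ʷ-map⁻ (qʷ (suc t))) (∈ʷ-◅◅⁻ (pF (suc t)) z∈)
        P-injective : ∀ {t t′} → P t ≡ P t′ → t ≡ t′
        P-injective {t} {t′} eq = p-disjoint (end∈ (pʷ t)) (subst (_∈ʷ pʷ t′) (sym eq) (end∈ (pʷ t′)))
        Q-injective : ∀ {t t′} → Q t ≡ Q t′ → t ≡ t′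
        Q-injective {t} {t′} eq = q-disjoint (start∈ (qʷ t)) (subst (_∈ʷ qʷ t′) (sym eq) (start∈ (qʷ t′)))
        -- Following p to z and then q leads from A to B, hence through the cut, which p meets at most
        -- at its end and q at most at its start.
        meet∈cut : ∀ {t t′ z} → z ∈ʷ pʷ t → z ∈ʷ qʷ t′ → z ∈ᶠ cut
        meet∈cut {t} {t′} z∈p z∈q with prefix (pʷ t) z∈p | suffix (qʷ t′) z∈q
        ... | p′ , _ | q′ , _ with crossing (proj₁ (proj₂ (p t))) (proj₁ (proj₂ (q t′)))
                                            (RTC.map proj₂ p′ ◅◅ RTC.map proj₁ q′)
        ... | c , c∈ , (i , refl) with ∈ʷ-◅◅⁻ (RTC.map proj₂ p′) c∈
        ... | inj₁ c∈p = i , Before-end p′ (∈ʷ-map⁻ p′ c∈p) (suc i , refl)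
        ... | inj₂ c∈q = i , After-start q′ (∈ʷ-map⁻ q′ c∈q) (suc i , refl)
        meet : ∀ {t t′ z} → z ∈ʷ pʷ t → z ∈ʷ qʷ t′ → t ≡ t′
        meet {t} {t′} z∈p z∈q with meet∈cut z∈p z∈q
        ... | i , refl = trans (sym (P-injective (Before-end (pʷ t) z∈p (suc i , refl))))
                               (Q-injective (After-start (qʷ t′) z∈q (suc i , refl)))
        disjoint : ∀ {t t′ z} → z ∈ʷ pʷ t ⊎ z ∈ʷ qʷ t → z ∈ʷ pʷ t′ ⊎ z ∈ʷ qʷ t′ → t ≡ t′
        disjoint (inj₁ z∈) (inj₁ z∈′) = p-disjoint z∈ z∈′
        disjoint (inj₁ z∈) (inj₂ z∈′) = meet z∈ z∈′
        disjoint (inj₂ z∈) (inj₁ z∈′) = sym (meet z∈′ z∈)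
        disjoint (inj₂ z∈) (inj₂ z∈′) = q-disjoint z∈ z∈′

    Edge : List (V × V) → Rel V 0ℓ
    Edge L u v = (u , v) ∈ L

    module _ {L : List (V × V)} {x y : V} {A B : V → Set} {m} (s : Separator (Edge L) A B m) where
      open Separator s

      -- In the enlarged graph too, a walk from `A` to `B` meets `x V.∷ cut`, and up to its first
      -- visit there it is a walk of the old graph. Intersecting the two certificates works because
      -- `S.Reached` contains neither `x` nor a vertex of `cut`.
      separatorVia-source : ∀ {n} → Separator (Edge L) A (_∈ᶠ x V.∷ cut) n → Separator (Edge ((x , y) ∷ L)) A B n
      separatorVia-source s′ = record
        { cut = S.cut ; Reached = λ v → S.Reached v × Reached v
        ; reached? = λ v → S.reached? v ×-dec reached? v
        ; source = λ Av → case S.source Av of λ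
            { (inj₁ v∈) → inj₁ v∈ ; (inj₂ Rv) → both Rv (source Av) }
        ; step = λ
            { (Ru , _)  (here refl) → contradiction (zero , refl) (S.target Ru)
            ; (Ru , R′u) (there e)  → case S.step Ru e of λ
                { (inj₁ v∈) → inj₁ v∈ ; (inj₂ Rv) → both Rv (step R′u e) } }
        ; target = target ∘ proj₂
        }
        where
        module S = Separator s′
        both : ∀ {v} → S.Reached v → v ∈ᶠ cut ⊎ Reached v → v ∈ᶠ S.cut ⊎ S.Reached v × Reached v
        both Rv (inj₁ (i , eq)) = contradiction (suc i , eq) (S.target Rv)
        both Rv (inj₂ R′v)      = inj₂ (Rv , R′v)

      -- The mirror image: after its last visit to `y V.∷ cut` a walk stays in the old graph. The
      -- certificate is now a union, since a walk may roam in `Reached` until it enters `y V.∷ cut`,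
      -- where `S.source` takes over.
      separatorVia-target : ∀ {n} → Separator (Edge L) (_∈ᶠ y V.∷ cut) B n → Separator (Edge ((x , y) ∷ L)) A B n
      separatorVia-target s′ = record
        { cut = S.cut ; Reached = λ v → Reached v ⊎ S.Reached v
        ; reached? = λ v → reached? v ⊎-dec S.reached? v
        ; source = either ∘ source
        ; step = λ
            { _ (here refl)         → Sum.map₂ inj₂ (S.source (zero , refl))
            ; (inj₁ Ru) (there e)   → either (step Ru e)
            ; (inj₂ R′u) (there e)  → Sum.map₂ inj₂ (S.step R′u e) }
        ; target = [ target , S.target ]′
        }
        where
        module S = Separator s′
        either : ∀ {v} → v ∈ᶠ cut ⊎ Reached v → v ∈ᶠ S.cut ⊎ Reached v ⊎ S.Reached v
        either (inj₁ (i , eq)) = Sum.map₂ inj₂ (S.source (suc i , eq))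
        either (inj₂ Rv)       = inj₂ (inj₁ Rv)

      separatorWith-source : Separator (Edge ((x , y) ∷ L)) A B (suc m)
      separatorWith-source = record
        { cut = x V.∷ cut ; Reached = λ v → Reached v × v ≢ x
        ; reached? = λ v → reached? v ×-dec ¬? (v ≟ x)
        ; source = add ∘ source
        ; step = λ { (_ , u≢x) (here refl) → contradiction refl u≢x ; (Ru , _) (there e) → add (step Ru e) }
        ; target = target ∘ proj₁
        }
        where
        add : ∀ {v} → v ∈ᶠ cut ⊎ Reached v → v ∈ᶠ x V.∷ cut ⊎ Reached v × v ≢ x
        add (inj₁ (i , eq)) = inj₁ (suc i , eq)
        add {v} (inj₂ Rv) with v ≟ x
        ... | yes refl = inj₁ (zero , refl)
        ... | no v≢x   = inj₂ (Rv , v≢x)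

    -- Göring's proof: delete an edge xy, take a minimum separator of the rest, and link A to the
    -- separator with x added, and the separator with y added to B.
    menger : (vs : List V) → Unique vs → (∀ v → v ∈ vs) →
             (L : List (V × V)) {A B : V → Set} → Decidable A → Decidable B →
             ∃₂ λ k m → m ≤ k × Linkage (Edge L) A B k × Separator (Edge L) A B m
    -- Without edges, the common vertices of `A` and `B` form both the trivial walks and the cut.
    menger vs unique complete [] {A} {B} A? B? = _ , _ , ℕ.≤-refl ,
      record { walk = λ _ → ε ; start-A = proj₁ ∘ common ; end-B = proj₂ ∘ common
             ; disjoint = λ eq eq′ → lookup-injective (Unique.filter⁺ AB? unique) (trans (sym eq) eq′) } ,
      record { cut = List.lookup C ; Reached = λ v → A v × ¬ B v ; reached? = λ v → A? v ×-dec ¬? (B? v)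
             ; source = source ; step = λ _ () ; target = proj₂ }
      where
      AB? = λ v → A? v ×-dec B? v
      C = List.filter AB? vs
      common : ∀ i → A (List.lookup C i) × B (List.lookup C i)
      common i = proj₂ (∈-filter⁻ AB? {xs = vs} (∈-lookup i))
      source : ∀ {v} → A v → v ∈ᶠ List.lookup C ⊎ A v × ¬ B v
      source {v} Av with B? v
      ... | no ¬Bv = inj₂ (Av , ¬Bv)
      ... | yes Bv = let v∈C = ∈-filter⁺ AB? (complete v) (Av , Bv) in inj₁ (index v∈C , sym (lookup-index v∈C))
    menger vs unique complete ((x , y) ∷ L) A? B?
      with k , m , m≤k , l , s ← menger vs unique complete L A? B?
      with j , n , n≤j , l₁ , s₁ ← menger vs unique complete L A? (_∈ᶠ? (x V.∷ Separator.cut s))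
      with j′ , n′ , n′≤j′ , l₂ , s₂ ← menger vs unique complete L (_∈ᶠ? (y V.∷ Separator.cut s)) B?
      -- A separator with at most `k` vertices matches the `k` walks already found. Otherwise both
      -- `n` and `n′` exceed `k`, hence `m`, so both new linkages have at least `m + 1` walks, one
      -- for each entry of the cut with `x` or `y` added.
      with n ℕ.≤? k | n′ ℕ.≤? k
    ... | yes n≤k | _ = k , n , n≤k , mapLinkage there l , separatorVia-source s s₁
    ... | no _ | yes n′≤k = k , n′ , n′≤k , mapLinkage there l , separatorVia-target s s₂
    ... | no n≰k | no n′≰k = suc m , suc m , ℕ.≤-refl ,
      join there s (here refl) (reachEvery _ (large n≰k n≤j) l₁) (leaveEvery _ (large n′≰k n′≤j′) l₂) ,
      separatorWith-source s
      where
      large : ∀ {n j} → ¬ n ≤ k → n ≤ j → suc m ≤ j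
      large n≰k n≤j = ℕ.≤-trans (ℕ.s≤s m≤k) (ℕ.≤-trans (ℕ.≰⇒> n≰k) n≤j)

open Menger

-- Ranks over reduced rings

module Rank {c ℓ} (R : CommutativeRing c ℓ) where
  open CommutativeRing R hiding (zero)
  open Algebra.Properties.Semiring.Sum semiring
  open Algebra.Properties.Ring ring using (-‿distribˡ-*)
  open import Relation.Binary.Reasoning.Setoid setoid

  sum-zero : ∀ {n} {f : Fin n → Carrier} → (∀ i → f i ≈ 0#) → sum f ≈ 0#
  sum-zero {n} f≈0 = trans (sum-cong-≋ f≈0) (sum-replicate-zero n)

  -- Bounding the rank by the number of outer products makes sense over any commutative ring and for
  -- arbitrary index sets, and needs no test for zero.
  data Rank≤ {X Y : Set} : ℕ → (X → Y → Carrier) → Set (c Level.⊔ ℓ) where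
    null : ∀ {M} → (∀ x y → M x y ≈ 0#) → Rank≤ 0 M
    plus : ∀ {r M N} (f : X → Carrier) (g : Y → Carrier) →
           (∀ x y → M x y ≈ f x * g y + N x y) → Rank≤ r N → Rank≤ (suc r) M

  module _ {X Y : Set} where

    Rank≤-cong : ∀ {r} {M N : X → Y → Carrier} → (∀ x y → N x y ≈ M x y) → Rank≤ r M → Rank≤ r N
    Rank≤-cong N≈M (null M≈0)       = null λ x y → trans (N≈M x y) (M≈0 x y)
    Rank≤-cong N≈M (plus f g M≈ ρ) = plus f g (λ x y → trans (N≈M x y) (M≈ x y)) ρ

    Rank≤-+ : ∀ {r s} {M N : X → Y → Carrier} →
              Rank≤ r M → Rank≤ s N → Rank≤ (r ℕ.+ s) (λ x y → M x y + N x y)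
    Rank≤-+ (null M≈0) ρ = Rank≤-cong (λ x y → trans (+-congʳ (M≈0 x y)) (+-identityˡ _)) ρ
    Rank≤-+ (plus f g M≈ ρ) σ = plus f g (λ x y → trans (+-congʳ (M≈ x y)) (+-assoc _ _ _)) (Rank≤-+ ρ σ)

    Rank≤-sum : ∀ {r} n {M : Fin n → X → Y → Carrier} →
                (∀ i → Rank≤ r (M i)) → Rank≤ (n ℕ.* r) (λ x y → sum λ i → M i x y)
    Rank≤-sum zero    ρ = null λ _ _ → refl
    Rank≤-sum (suc n) ρ = Rank≤-+ (ρ zero) (Rank≤-sum n (ρ ∘ suc))

    Rank≤-outer : (f : X → Carrier) (g : Y → Carrier) → Rank≤ 1 (λ x y → f x * g y)
    Rank≤-outer f g = plus {N = λ _ _ → 0#} f g (λ _ _ → sym (+-identityʳ _)) (null λ _ _ → refl)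

  -- Stating the hypothesis up to `≈` builds in compatibility with pointwise equality, besides
  -- additivity and homogeneity.
  Linear : ∀ {Y Z : Set} → ((Y → Carrier) → Z → Carrier) → Set (c Level.⊔ ℓ)
  Linear φ = ∀ {f g h} a → (∀ y → h y ≈ a * f y + g y) → ∀ z → φ h z ≈ a * φ f z + φ g z

  linear-zero : ∀ {Y Z : Set} {φ : (Y → Carrier) → Z → Carrier} → Linear φ →
                ∀ {f} → (∀ y → f y ≈ 0#) → ∀ z → φ f z ≈ 0#
  linear-zero {φ = φ} linear {f} f≈0 z = begin
    φ f z                        ≈⟨ linear {f} {f} (- 1#) f≈-f+f z ⟩
    - 1# * φ f z + φ f z         ≈⟨ +-congʳ (-1*x≈-x (φ f z)) ⟩
    - φ f z + φ f z              ≈⟨ -‿inverseˡ _ ⟩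
    0#                           ∎
    where
    open Algebra.Properties.Ring ring using (-1*x≈-x)
    f≈-f+f : ∀ y → f y ≈ - 1# * f y + f y
    f≈-f+f y = trans (f≈0 y) (sym (trans (+-congʳ (-1*x≈-x (f y))) (-‿inverseˡ _)))

  Rank≤-linear : ∀ {X Y Z : Set} {r} {M : X → Y → Carrier} {φ : (Y → Carrier) → Z → Carrier} →
                 Linear φ → Rank≤ r M → Rank≤ r (φ ∘ M)
  Rank≤-linear linear (null M≈0)      = null (linear-zero linear ∘ M≈0)
  Rank≤-linear {φ = φ} linear (plus f g M≈ ρ) =
    plus f (φ g) (λ x → linear (f x) (M≈ x)) (Rank≤-linear linear ρ)

  module _ {n} (g : Fin (suc n) → Carrier) (j : Fin (suc n)) where
    private
      p = g j
      γ : Fin n → Carrier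
      γ k = - g (punchIn j k)

    -- One column step of fraction-free Gaussian elimination: column `j`, with pivot `g j`, clears
    -- the row `g` from the other columns and is dropped.
    eliminate : (Fin (suc n) → Carrier) → Fin n → Carrier
    eliminate f k = p * f (punchIn j k) + γ k * f j

    -- The transpose of `eliminate`: it turns a relation among the remaining columns into a relation
    -- among the original ones that is also orthogonal to `g`.
    eliminateᵀ : (Fin n → Carrier) → Fin (suc n) → Carrier
    eliminateᵀ a = V.insertAt (λ k → p * a k) j (sum λ k → γ k * a k)

    eliminate-linear : Linear eliminate
    eliminate-linear {f} {g} {h} a h≈ k = trans (+-cong (*-congˡ (h≈ _)) (*-congˡ (h≈ _)))
      (solve 7 (λ p γ a f f′ g g′ →
          p :* (a :* f :+ g) :+ γ :* (a :* f′ :+ g′) := a :* (p :* f :+ γ :* f′) :+ (p :* g :+ γ :* g′))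
        refl p (γ k) a (f (punchIn j k)) (f j) (g (punchIn j k)) (g j))
      where open SemiringSolver commutativeSemiring

    eliminate-pivot : ∀ k → eliminate g k ≈ 0#
    eliminate-pivot k = begin
      p * x + - x * p    ≈⟨ +-cong (*-comm p x) (sym (-‿distribˡ-* x p)) ⟩
      x * p + - (x * p)  ≈⟨ -‿inverseʳ (x * p) ⟩
      0#                 ∎
      where x = g (punchIn j k)

    eliminateᵀ-adjoint : ∀ a f → sum (λ i → eliminateᵀ a i * f i) ≈ sum (λ k → a k * eliminate f k)
    eliminateᵀ-adjoint a f = begin
      sum (λ i → eliminateᵀ a i * f i)
        ≈⟨ sum-remove {i = j} (λ i → eliminateᵀ a i * f i) ⟩
      eliminateᵀ a j * f j + sum (λ k → eliminateᵀ a (punchIn j k) * f (punchIn j k))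
        ≈⟨ +-cong (*-congʳ (reflexive (V.insertAt-lookup (λ k → p * a k) j _)))
                  (sum-cong-≋ λ k → *-congʳ (reflexive (V.insertAt-punchIn (λ k → p * a k) j _ k))) ⟩
      sum (λ k → γ k * a k) * f j + sum (λ k → p * a k * f (punchIn j k))
        ≈⟨ +-congʳ (*-distribʳ-sum (f j) λ k → γ k * a k) ⟩
      sum (λ k → γ k * a k * f j) + sum (λ k → p * a k * f (punchIn j k))
        ≈⟨ ∑-distrib-+ (λ k → γ k * a k * f j) (λ k → p * a k * f (punchIn j k)) ⟨
      sum (λ k → γ k * a k * f j + p * a k * f (punchIn j k))
        ≈⟨ sum-cong-≋ (λ k → solve 5 (λ p γ a f f′ → γ :* a :* f′ :+ p :* a :* f := a :* (p :* f :+ γ :* f′))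
                               refl p (γ k) (a k) (f (punchIn j k)) (f j)) ⟩
      sum (λ k → a k * eliminate f k)
        ∎
      where open SemiringSolver commutativeSemiring

  module _ (reduced : ∀ x → x * x ≈ 0# → x ≈ 0#) where

    private
      _⊥_ : ∀ {n} → (Fin n → Carrier) → (Fin n → Carrier) → Set ℓ
      a ⊥ f = sum (λ i → a i * f i) ≈ 0#

    -- The element q, instead of q = 1, lets elimination work without dividing by a pivot or deciding
    -- whether it vanishes: the induction yields q g j ≈ 0 for every entry g j of a row, and then q² ≈ 0.
    annihilator-zero : ∀ {X : Set} {r n} {M : X → Fin n → Carrier} → Rank≤ r M → r < n → ∀ q →
                       (∀ a → (∀ x → a ⊥ M x) → ∀ i → q * a i ≈ 0#) → q ≈ 0#
    annihilator-zero {n = suc n} (null M≈0) _ q kills =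
      trans (sym (*-identityʳ q)) (kills (λ _ → 1#) (λ x → sum-zero λ i → trans (*-identityˡ _) (M≈0 x i)) zero)
    annihilator-zero {n = suc n} {M} (plus {N = N} f g M≈ ρ) (ℕ.s≤s r<n) q kills =
      -- Once `q` kills every entry of `g`, the multiple `q a` of a relation `a` of `N` is a
      -- relation of `M`, so `q * q` satisfies the hypothesis for `N`, which needs one outer product
      -- fewer.
      reduced q (annihilator-zero ρ (ℕ.m≤n⇒m≤1+n r<n) (q * q) λ a a⊥N i →
        trans (*-assoc q q (a i)) (kills (λ i → q * a i) (λ x → q*-relation a x (a⊥N x)) i))
      where
      M-row : ∀ a x → a ⊥ g → a ⊥ N x → a ⊥ M x
      M-row a x a⊥g a⊥N = begin
        sum (λ i → a i * M x i)
          ≈⟨ sum-cong-≋ (λ i → *-congˡ {a i} (M≈ x i)) ⟩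
        sum (λ i → a i * (f x * g i + N x i))
          ≈⟨ sum-cong-≋ (λ i → solve 4 (λ a f g n → a :* (f :* g :+ n) := f :* (a :* g) :+ a :* n)
                                 refl (a i) (f x) (g i) (N x i)) ⟩
        sum (λ i → f x * (a i * g i) + a i * N x i)
          ≈⟨ ∑-distrib-+ (λ i → f x * (a i * g i)) (λ i → a i * N x i) ⟩
        sum (λ i → f x * (a i * g i)) + sum (λ i → a i * N x i)
          ≈⟨ +-cong (sym (*-distribˡ-sum (f x) (λ i → a i * g i))) a⊥N ⟩
        f x * sum (λ i → a i * g i) + 0#
          ≈⟨ +-identityʳ _ ⟩
        f x * sum (λ i → a i * g i)
          ≈⟨ *-congˡ a⊥g ⟩
        f x * 0#
          ≈⟨ zeroʳ (f x) ⟩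
        0# ∎
        where open SemiringSolver commutativeSemiring
      q*g≈0 : ∀ j → q * g j ≈ 0#
      -- Eliminating column `j` from `N` leaves `n` columns and still `r` outer products. A relation
      -- `a` there pulls back to a relation of `M` with entries `g j * a k` away from `j`, so
      -- `q * g j` is again a killing element.
      q*g≈0 j = annihilator-zero (Rank≤-linear (eliminate-linear g j) ρ) r<n (q * g j) λ a a⊥ k → begin
        q * g j * a k                          ≈⟨ *-assoc q (g j) (a k) ⟩
        q * (g j * a k)                        ≈⟨ *-congˡ (reflexive (V.insertAt-punchIn (λ k → g j * a k) j _ k)) ⟨
        q * eliminateᵀ g j a (punchIn j k)     ≈⟨ kills (eliminateᵀ g j a) (λ x → M-row (eliminateᵀ g j a) x
                                                    (trans (eliminateᵀ-adjoint g j a g)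
                                                           (sum-zero λ k → trans (*-congˡ (eliminate-pivot g j k)) (zeroʳ _)))
                                                    (trans (eliminateᵀ-adjoint g j a (N x)) (a⊥ x))) (punchIn j k) ⟩
        0# ∎
      q*-relation : ∀ a x → a ⊥ N x → (λ i → q * a i) ⊥ M x
      q*-relation a x a⊥N = M-row (λ i → q * a i) x
        (sum-zero λ i → begin
          q * a i * g i    ≈⟨ *-congʳ (*-comm q (a i)) ⟩
          a i * q * g i    ≈⟨ *-assoc (a i) q (g i) ⟩
          a i * (q * g i)  ≈⟨ *-congˡ (q*g≈0 i) ⟩
          a i * 0#         ≈⟨ zeroʳ (a i) ⟩
          0#               ∎)
        (begin
          sum (λ i → q * a i * N x i)    ≈⟨ sum-cong-≋ (λ i → *-assoc q (a i) (N x i)) ⟩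
          sum (λ i → q * (a i * N x i))  ≈⟨ *-distribˡ-sum q (λ i → a i * N x i) ⟨
          q * sum (λ i → a i * N x i)    ≈⟨ *-congˡ a⊥N ⟩
          q * 0#                         ≈⟨ zeroʳ q ⟩
          0#                             ∎)

-- ℝ and ℂ are reduced

module ≈ℝ = IsEquivalence ≈ℝ-isEquivalence

-- Tolerance `ε` for `x` comes from tolerance `ε` squared for its square; the root is taken between
-- rationals, where the order is decidable.
≈ℝ-reduced : ∀ {x} → x *ℝ x ≈ℝ ιℝ 0ℚ → x ≈ℝ ιℝ 0ℚ
close (≈ℝ-reduced {x} xx≈0) ε 0<ε =
  let N , h = close xx≈0 (ε ℚ.* ε) (ℚ.positive⁻¹ _ {{ℚ.pos*pos⇒pos ε ε}})
  in N , λ n N≤n → ≡.subst (ℚ._< ε) (≡.cong ℚ.∣_∣ (≡.sym (ℚ.+-identityʳ (seq x n))))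
                     (root (seq x n) (≡.subst (ℚ._< ε ℚ.* ε) (square (seq x n)) (h n N≤n)))
  where
  instance
    ε-positive : ℚ.Positive ε
    ε-positive = ℚ.positive 0<ε
    ε-nonNegative : ℚ.NonNegative ε
    ε-nonNegative = ℚ.pos⇒nonNeg ε
  square : ∀ a → ℚ.∣ a ℚ.* a ℚ.- 0ℚ ∣ ≡ ℚ.∣ a ∣ ℚ.* ℚ.∣ a ∣
  square a = ≡.trans (≡.cong ℚ.∣_∣ (ℚ.+-identityʳ (a ℚ.* a))) (ℚ.∣p*q∣≡∣p∣*∣q∣ a a)
  root : ∀ a → ℚ.∣ a ∣ ℚ.* ℚ.∣ a ∣ ℚ.< ε ℚ.* ε → ℚ.∣ a ∣ ℚ.< ε
  root a aa<εε with ℚ.∣ a ∣ ℚ.<? ε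
  ... | yes a<ε = a<ε
  ... | no a≮ε = contradiction (ℚ.<-≤-trans aa<εε
    (ℚ.≤-trans (ℚ.*-monoʳ-≤-nonNeg ε (ℚ.≮⇒≥ a≮ε))
               (ℚ.*-monoˡ-≤-nonNeg ℚ.∣ a ∣ {{ℚ.∣-∣-nonNeg a}} (ℚ.≮⇒≥ a≮ε)))) (ℚ.<-irrefl ≡.refl)

-- For z = a + ib, z² = 0 gives a² - b² = 0 and ab = 0; the half in `h` turns the imaginary part ab
-- + ba into ab. Then a⁴ = a²(a² - b²) + (ab)² and b⁴ = -b²(a² - b²) + (ab)² vanish, and the real
-- case applies twice to each.
≈ℂ-reduced : ∀ z → z *ℂ z ≈ℂ 0ℂ → z ≈ℂ 0ℂ
≈ℂ-reduced z zz≈0 = ≈ℝ-reduced (≈ℝ-reduced a⁴≈0) ,≈ ≈ℝ-reduced (≈ℝ-reduced b⁴≈0)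
  where
  a = re z
  b = im z
  u = (a *ℝ a) +ℝ (-ℝ (b *ℝ b))
  h = ιℝ ½ *ℝ ((a *ℝ b) +ℝ (b *ℝ a))
  0ℝ = ιℝ 0ℚ
  h≈0 : h ≈ℝ 0ℝ
  h≈0 = ≈ℝ.trans (*ℝ-cong ≈ℝ.refl (im≈ zz≈0)) (pointwise⇒≈ℝ λ _ → ≡.refl)
  u≈0 : u ≈ℝ 0ℝ
  u≈0 = re≈ zz≈0
  open ℚ-Solver.+-*-Solver
  a⁴≈0 : (a *ℝ a) *ℝ (a *ℝ a) ≈ℝ 0ℝ
  a⁴≈0 = ≈ℝ.trans {j = ((a *ℝ a) *ℝ u) +ℝ (h *ℝ h)}
    (pointwise⇒≈ℝ λ n → solve 2 (λ a b → (a :* a) :* (a :* a) :=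
      (a :* a) :* (a :* a :+ (:- (b :* b))) :+ (con ½ :* (a :* b :+ b :* a)) :* (con ½ :* (a :* b :+ b :* a)))
      ≡.refl (seq a n) (seq b n))
    (≈ℝ.trans (+ℝ-cong (*ℝ-cong ≈ℝ.refl u≈0) (*ℝ-cong h≈0 h≈0))
      (pointwise⇒≈ℝ λ n → solve 1 (λ a → (a :* a) :* con 0ℚ :+ con 0ℚ :* con 0ℚ := con 0ℚ) ≡.refl (seq a n)))
  b⁴≈0 : (b *ℝ b) *ℝ (b *ℝ b) ≈ℝ 0ℝ
  b⁴≈0 = ≈ℝ.trans {j = (-ℝ ((b *ℝ b) *ℝ u)) +ℝ (h *ℝ h)}
    (pointwise⇒≈ℝ λ n → solve 2 (λ a b → (b :* b) :* (b :* b) :=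
      :- ((b :* b) :* (a :* a :+ (:- (b :* b)))) :+ (con ½ :* (a :* b :+ b :* a)) :* (con ½ :* (a :* b :+ b :* a)))
      ≡.refl (seq a n) (seq b n))
    (≈ℝ.trans (+ℝ-cong (-ℝ-cong (*ℝ-cong ≈ℝ.refl u≈0)) (*ℝ-cong h≈0 h≈0))
      (pointwise⇒≈ℝ λ n → solve 1 (λ b → :- ((b :* b) :* con 0ℚ) :+ con 0ℚ :* con 0ℚ := con 0ℚ) ≡.refl (seq b n)))

1≉0 : ¬ 1ℂ ≈ℂ 0ℂ
1≉0 eq = let N , h = close (re≈ eq) 1ℚ (ℚ.positive⁻¹ 1ℚ) in ℚ.<-irrefl ≡.refl (h N ℕ.≤-refl)

open CommutativeRing ℂ-commutativeRing hiding (zero)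
open Algebra.Properties.Semiring.Sum semiring
  using (sum-cong-≋; ∑-comm; ∑-distrib-+; *-distribˡ-sum; *-distribʳ-sum; sum-remove)
module ∏ = Algebra.Properties.CommutativeMonoid.Sum *-commutativeMonoid
open Rank ℂ-commutativeRing
open import Relation.Binary.Reasoning.Setoid setoid hiding (start)

-- Sums over product bases

tabulate⁺-cong : ∀ {n} {c : Fin n → ℕ} {f g : ∀ i → Fin (c i)} → (∀ i → f i ≡ g i) →
                 tabulate⁺ {P = Fin} {f = c} f ≡ tabulate⁺ g
tabulate⁺-cong {zero}  f≡g = ≡.refl
tabulate⁺-cong {suc n} f≡g = ≡.cong₂ _∷_ (f≡g zero) (tabulate⁺-cong (f≡g ∘ suc))

tabulate⁻-tabulate⁺ : ∀ {n} {c : Fin n → ℕ} (f : ∀ i → Fin (c i)) i → tabulate⁻ (tabulate⁺ {P = Fin} {f = c} f) i ≡ f i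
tabulate⁻-tabulate⁺ f zero    = ≡.refl
tabulate⁻-tabulate⁺ f (suc i) = tabulate⁻-tabulate⁺ (f ∘ suc) i

Index-ext : ∀ {n} {c : Fin n → ℕ} {W W′ : Index c} → (∀ i → tabulate⁻ W i ≡ tabulate⁻ W′ i) → W ≡ W′
Index-ext {zero}  {W = []}    {[]}     _ = ≡.refl
Index-ext {suc n} {W = _ ∷ _} {_ ∷ _} eq = ≡.cong₂ _∷_ (eq zero) (Index-ext (eq ∘ suc))

∑All-cong : ∀ {n} {cs : Vec ℕ n} {f g : All Fin cs → ℂ} → (∀ W → f W ≈ g W) → ∑All f ≈ ∑All g
∑All-cong {cs = []}    f≈g = f≈g []
∑All-cong {cs = _ ∷ _} f≈g = sum-cong-≋ λ i → ∑All-cong λ W → f≈g (i ∷ W)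

∑All-linear : ∀ {n} {cs : Vec ℕ n} a (f g : All Fin cs → ℂ) →
              ∑All (λ W → a * f W + g W) ≈ a * ∑All f + ∑All g
∑All-linear {cs = []}    a f g = refl
∑All-linear {cs = c ∷ _} a f g = begin
  ∑ (λ i → ∑All λ W → a * f (i ∷ W) + g (i ∷ W))
    ≈⟨ sum-cong-≋ {c} (λ i → ∑All-linear a (f ∘ (i ∷_)) (g ∘ (i ∷_))) ⟩
  ∑ (λ i → a * ∑All (f ∘ (i ∷_)) + ∑All (g ∘ (i ∷_)))
    ≈⟨ ∑-distrib-+ {c} (λ i → a * ∑All (f ∘ (i ∷_))) (λ i → ∑All (g ∘ (i ∷_))) ⟩
  ∑ (λ i → a * ∑All (f ∘ (i ∷_))) + ∑ (λ i → ∑All (g ∘ (i ∷_)))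
    ≈⟨ +-congʳ (*-distribˡ-sum {c} a (λ i → ∑All (f ∘ (i ∷_)))) ⟨
  a * ∑ (λ i → ∑All (f ∘ (i ∷_))) + ∑ (λ i → ∑All (g ∘ (i ∷_)))
    ∎

∑-∑All-comm : ∀ {m n} {cs : Vec ℕ n} (f : Fin m → All Fin cs → ℂ) →
              ∑ (λ i → ∑All (f i)) ≈ ∑All (λ W → ∑ λ i → f i W)
∑-∑All-comm         {cs = []}    f = refl
∑-∑All-comm {m} {cs = c ∷ _} f = begin
  ∑ (λ i → ∑ λ j → ∑All (f i ∘ (j ∷_)))  ≈⟨ ∑-comm {m} {c} (λ i j → ∑All (f i ∘ (j ∷_))) ⟩
  ∑ (λ j → ∑ λ i → ∑All (f i ∘ (j ∷_)))  ≈⟨ sum-cong-≋ {c} (λ j → ∑-∑All-comm λ i → f i ∘ (j ∷_)) ⟩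
  ∑ (λ j → ∑All λ W → ∑ λ i → f i (j ∷ W)) ∎

-- The rank is at most the capacity of any cut

data Kind : Set where
  inS inT cut : Kind

factor : Kind → ℕ → ℕ → ℕ
factor inS _ w = w
factor inT _ w = w
factor cut c w = c ℕ.* w

-- The capacity of the cut, in the recursive form that follows the nested sums of `∑Index`.
weight : ∀ {n} → (Fin n → ℕ) → (Fin n → Kind) → ℕ
weight {zero}  c κ = 1
weight {suc n} c κ = factor (κ zero) (c zero) (weight (c ∘ suc) (κ ∘ suc))

module _ {n} {c : Fin n → ℕ} where

  infix 4 _≡[_]_

  _≡[_]_ : Index c → (Fin n → Set) → Index c → Set
  W ≡[ P ] W′ = ∀ e → P e → tabulate⁻ W e ≡ tabulate⁻ W′ e

-- The sums are treated one edge at a time. `F` ignores an edge inside S̄, so that sum can be moved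
-- into `G` without raising the bound; for an edge inside T̄ it moves into `F`. Only a cut edge
-- splits the matrix into as many summands as its capacity.
Rank≤-∑Index : ∀ {X Y : Set} {n} (c : Fin n → ℕ) → (∀ e → 0 < c e) → (κ : Fin n → Kind)
  (F : Index c → X → ℂ) (G : Index c → Y → ℂ) →
  (∀ {W W′} → W ≡[ (λ e → κ e ≢ inS) ] W′ → ∀ x → F W x ≈ F W′ x) →
  (∀ {W W′} → W ≡[ (λ e → κ e ≢ inT) ] W′ → ∀ y → G W y ≈ G W′ y) →
  Rank≤ (weight c κ) (λ x y → ∑Index c λ W → F W x * G W y)
Rank≤-∑Index {n = zero}  c 0<c κ F G F-local G-local = Rank≤-outer (F []) (G [])
Rank≤-∑Index {X} {Y} {suc n} c 0<c κ F G F-local G-local with κ zero in κ₀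
... | cut = Rank≤-sum (c zero) λ i → Rank≤-∑Index (c ∘ suc) (0<c ∘ suc) (κ ∘ suc) (F ∘ (i ∷_)) (G ∘ (i ∷_))
  (λ W≡W′ → F-local λ { zero _ → ≡.refl ; (suc e) → W≡W′ e })
  (λ W≡W′ → G-local λ { zero _ → ≡.refl ; (suc e) → W≡W′ e })
... | inS = Rank≤-cong
  (λ x y → begin
    ∑ (λ i → ∑All λ W → F (i ∷ W) x * G (i ∷ W) y)
      ≈⟨ ∑-∑All-comm {c zero} (λ i W → F (i ∷ W) x * G (i ∷ W) y) ⟩
    ∑All (λ W → ∑ λ i → F (i ∷ W) x * G (i ∷ W) y)
      ≈⟨ ∑All-cong (λ W → sum-cong-≋ {c zero} λ i → *-congʳ {G (i ∷ W) y} (F₀ i W x)) ⟩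
    ∑All (λ W → ∑ λ i → F (o ∷ W) x * G (i ∷ W) y)
      ≈⟨ ∑All-cong (λ W → *-distribˡ-sum {c zero} (F (o ∷ W) x) (λ i → G (i ∷ W) y)) ⟨
    ∑All (λ W → F (o ∷ W) x * ∑ λ i → G (i ∷ W) y)
      ∎)
  (Rank≤-∑Index (c ∘ suc) (0<c ∘ suc) (κ ∘ suc) (F ∘ (o ∷_)) (λ W y → ∑ λ i → G (i ∷ W) y)
    (λ W≡W′ → F-local λ { zero _ → ≡.refl ; (suc e) → W≡W′ e })
    (λ W≡W′ y → sum-cong-≋ {c zero} λ i → G-local (λ { zero _ → ≡.refl ; (suc e) → W≡W′ e }) y))
  where
  -- A placeholder for the index that `F` ignores; it exists because capacities are positive.
  o = fromℕ< (0<c zero)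
  F₀ : ∀ i W x → F (i ∷ W) x ≈ F (o ∷ W) x
  F₀ i W = F-local λ { zero κ₀≢inS → contradiction κ₀ κ₀≢inS ; (suc e) _ → ≡.refl }
... | inT = Rank≤-cong
  (λ x y → begin
    ∑ (λ i → ∑All λ W → F (i ∷ W) x * G (i ∷ W) y)
      ≈⟨ ∑-∑All-comm {c zero} (λ i W → F (i ∷ W) x * G (i ∷ W) y) ⟩
    ∑All (λ W → ∑ λ i → F (i ∷ W) x * G (i ∷ W) y)
      ≈⟨ ∑All-cong (λ W → sum-cong-≋ {c zero} λ i → *-congˡ {F (i ∷ W) x} (G₀ i W y)) ⟩
    ∑All (λ W → ∑ λ i → F (i ∷ W) x * G (o ∷ W) y)
      ≈⟨ ∑All-cong (λ W → *-distribʳ-sum {c zero} (G (o ∷ W) y) (λ i → F (i ∷ W) x)) ⟨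
    ∑All (λ W → (∑ λ i → F (i ∷ W) x) * G (o ∷ W) y)
      ∎)
  (Rank≤-∑Index (c ∘ suc) (0<c ∘ suc) (κ ∘ suc) (λ W x → ∑ λ i → F (i ∷ W) x) (G ∘ (o ∷_))
    (λ W≡W′ x → sum-cong-≋ {c zero} λ i → F-local (λ { zero _ → ≡.refl ; (suc e) → W≡W′ e }) x)
    (λ W≡W′ → G-local λ { zero _ → ≡.refl ; (suc e) → W≡W′ e }))
  where
  o = fromℕ< (0<c zero)
  G₀ : ∀ i W y → G (i ∷ W) y ≈ G (o ∷ W) y
  G₀ i W = G-local λ { zero κ₀≢inT → contradiction κ₀ κ₀≢inT ; (suc e) _ → ≡.refl }

-- Each basis vector of the image is `M` applied to some vector, so the matrix with these vectors as
-- columns inherits the decomposition of `M`. If `r` exceeded `s`, independence would make `1#` a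
-- killing element for `annihilator-zero`.
HasRank⇒≤ : ∀ {m n} {c : Fin m → ℕ} {c′ : Fin n → ℕ} {M : Hom c c′} {r s} → Rank≤ s M → HasRank M r → r ≤ s
HasRank⇒≤ {c = c} {M = M} {r} {s} ρ (b , b-image , independent , _) with r ℕ.≤? s
... | yes r≤s = r≤s
... | no r≰s = contradiction
  (annihilator-zero ≈ℂ-reduced (Rank≤-cong (λ J i → proj₂ (b-image i) J) (Rank≤-linear apply-linear ρ))
    (ℕ.≰⇒> r≰s) 1# (λ a a⊥b i → trans (*-identityˡ (a i)) (independent a a⊥b i)))
  1≉0
  where
  φ : (Index c → ℂ) → Fin r → ℂ
  φ row i = ∑Index c λ I → row I * proj₁ (b-image i) I
  apply-linear : Linear φ
  apply-linear {f} {g} {h} a h≈ i = trans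
    (∑All-cong λ I → trans (*-congʳ (h≈ I)) (trans (distribʳ (v I) (a * f I) (g I)) (+-congʳ (*-assoc a (f I) (v I)))))
    (∑All-linear a (λ I → f I * v I) (λ I → g I * v I))
    where v = proj₁ (b-image i)

indicator : ∀ {P : Set} → Dec P → ℂ
indicator P? = if does P? then 1# else 0#

indicator-cong : ∀ {P Q : Set} (P? : Dec P) (Q? : Dec Q) → P ⇔ Q → indicator P? ≡ indicator Q?
indicator-cong P? Q? P⇔Q = ≡.cong (if_then 1# else 0#) (does-⇔ P⇔Q P? Q?)

module CutBound (G : Template) where
  open Template G

  module _ (side : Node #S #T #V → Bool)
           (side-input : ∀ u → side (input u) ≡ true) (side-output : ∀ u → side (output u) ≡ false) where

    kindOf : Bool → Bool → Kind
    kindOf true  true  = inS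
    kindOf false false = inT
    kindOf _     _     = cut

    kind : Fin #E → Kind
    kind e = kindOf (side (endpoint (e , 0F))) (side (endpoint (e , 1F)))

    kind-inS : ∀ h → side (endpoint h) ≡ false → kind (proj₁ h) ≢ inS
    kind-inS (e , 0F) eq with side (endpoint (e , 0F))
    kind-inS (e , 0F) () | true
    ... | false with side (endpoint (e , 1F))
    ... | true  = λ ()
    ... | false = λ ()
    kind-inS (e , 1F) eq with side (endpoint (e , 1F)) | side (endpoint (e , 0F))
    ... | false | true  = λ ()
    ... | false | false = λ ()

    kind-inT : ∀ h → side (endpoint h) ≡ true → kind (proj₁ h) ≢ inT
    kind-inT (e , 0F) eq with side (endpoint (e , 0F)) | side (endpoint (e , 1F))
    ... | true | true  = λ ()
    ... | true | false = λ ()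
    kind-inT (e , 1F) eq with side (endpoint (e , 1F)) | side (endpoint (e , 0F))
    ... | true | true  = λ ()
    ... | true | false = λ ()

    kind-cut : ∀ e → kind e ≡ cut ⇔ side (endpoint (e , 0F)) ≢ side (endpoint (e , 1F))
    kind-cut e with side (endpoint (e , 0F)) | side (endpoint (e , 1F))
    ... | true  | true  = mk⇔ (λ ()) (λ ≢ → contradiction ≡.refl ≢)
    ... | false | false = mk⇔ (λ ()) (λ ≢ → contradiction ≡.refl ≢)
    ... | true  | false = mk⇔ (λ _ ()) (λ _ → ≡.refl)
    ... | false | true  = mk⇔ (λ _ ()) (λ _ → ≡.refl)

    weight-filter : ∀ {n} (g : Fin n → Fin #E) {P : Fin #E → Set} (P? : ∀ e → Dec (P e)) → (∀ e → P e ⇔ kind e ≡ cut) →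
      product (List.map capacity (List.filter P? (List.tabulate g))) ≡ weight (capacity ∘ g) (kind ∘ g)
    weight-filter {zero}  g P? P⇔ = ≡.refl
    weight-filter {suc n} g P? P⇔ with P? (g zero) | kind (g zero) in eq
    ... | yes _  | cut = ≡.cong (capacity (g zero) ℕ.*_) (weight-filter (g ∘ suc) P? P⇔)
    ... | no _   | inS = weight-filter (g ∘ suc) P? P⇔
    ... | no _   | inT = weight-filter (g ∘ suc) P? P⇔
    ... | no ¬p  | cut = contradiction (Equivalence.from (P⇔ _) eq) ¬p
    ... | yes p  | inS = case ≡.trans (≡.sym eq) (Equivalence.to (P⇔ _) p) of λ ()
    ... | yes p  | inT = case ≡.trans (≡.sym eq) (Equivalence.to (P⇔ _) p) of λ ()

    restrict-cong : ∀ {k} (e : Fin k → Fin #E) {W W′ : Index capacity} →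
      (∀ i → tabulate⁻ W (e i) ≡ tabulate⁻ W′ (e i)) → restrict G e W ≡ restrict G e W′
    restrict-cong e W≡W′ = tabulate⁺-cong W≡W′

    indicator-agree-cong : ∀ {k} (e : Fin k → Fin #E) {W W′ : Index capacity} →
      (∀ i → tabulate⁻ W (e i) ≡ tabulate⁻ W′ (e i)) → ∀ I → indicator (agree? G e W I) ≡ indicator (agree? G e W′ I)
    indicator-agree-cong e {W} {W′} W≡W′ I = indicator-cong (agree? G e W I) (agree? G e W′ I)
      (mk⇔ (λ W~I u → ≡.trans (≡.sym (W≡W′ u)) (W~I u)) (λ W′~I u → ≡.trans (W≡W′ u) (W′~I u)))

    module _ (𝒯 : TensorAssignment G) where
      t : Fin #V → Index capacity → ℂ
      t v W = 𝒯 v (restrict G (edgeAt v) W)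

      -- The product over all vertices is split by side, with the factor 1 standing for the vertices
      -- of the opposite side.
      tᵀ tˢ : Index capacity → Fin #V → ℂ
      tᵀ W v = if side (vertex v) then 1# else t v W
      tˢ W v = if side (vertex v) then t v W else 1#

      F : Index capacity → Index (capacity ∘ outputEdge) → ℂ
      F W J = indicator (agree? G outputEdge W J) * ∏ (tᵀ W)

      H : Index capacity → Index (capacity ∘ inputEdge) → ℂ
      H W I = indicator (agree? G inputEdge W I) * ∏ (tˢ W)

      t-split : ∀ W v → t v W ≈ tᵀ W v * tˢ W v
      t-split W v with side (vertex v)
      ... | true  = sym (*-identityˡ _)
      ... | false = sym (*-identityʳ _)

      β-split : ∀ J I → β G 𝒯 J I ≈ ∑Index capacity λ W → F W J * H W I
      β-split J I = ∑All-cong split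
        where
        split : ∀ W → (if does (agree? G inputEdge W I ×-dec agree? G outputEdge W J) then ∏ (λ v → t v W) else 0#)
                      ≈ F W J * H W I
        split W with does (agree? G inputEdge W I) | does (agree? G outputEdge W J)
        ... | true  | true  = begin
          ∏ (λ v → t v W)                        ≈⟨ ∏.sum-cong-≋ (t-split W) ⟩
          ∏ (λ v → tᵀ W v * tˢ W v)              ≈⟨ ∏.∑-distrib-+ (tᵀ W) (tˢ W) ⟩
          ∏ (tᵀ W) * ∏ (tˢ W)                    ≈⟨ *-cong (*-identityˡ (∏ (tᵀ W))) (*-identityˡ (∏ (tˢ W))) ⟨
          1# * ∏ (tᵀ W) * (1# * ∏ (tˢ W))        ∎
        ... | false | true  = sym (trans (*-congˡ (zeroˡ _)) (zeroʳ _))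
        ... | true  | false = sym (trans (*-congʳ (zeroˡ _)) (zeroˡ _))
        ... | false | false = sym (trans (*-congʳ (zeroˡ _)) (zeroˡ _))

      endAt : ∀ v i → endpoint (proj₁ (Inverse.to (ordering v) i)) ≡ vertex v
      endAt v i = proj₂ (Inverse.to (ordering v) i)

      -- An edge inside S̄ ends neither at an output nor at a vertex of T̄, and `F` reads no other
      -- edges.
      F-local : ∀ {W W′} → W ≡[ (λ e → kind e ≢ inS) ] W′ → ∀ J → F W J ≈ F W′ J
      F-local {W} {W′} W≡W′ J = *-cong
        (reflexive (indicator-agree-cong outputEdge {W} {W′} (λ u → W≡W′ _ (kind-inS (proj₁ (outputEnd u))
          (≡.trans (≡.cong side (proj₁ (proj₂ (outputEnd u)))) (side-output u)))) J))
        (∏.sum-cong-≋ tᵀ-local)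
        where
        tᵀ-local : ∀ v → tᵀ W v ≈ tᵀ W′ v
        tᵀ-local v with side (vertex v) in eq
        ... | true  = refl
        ... | false = reflexive (≡.cong (𝒯 v) (restrict-cong (edgeAt v) {W} {W′} λ i → W≡W′ _
          (kind-inS (proj₁ (Inverse.to (ordering v) i)) (≡.trans (≡.cong side (endAt v i)) eq))))

      H-local : ∀ {W W′} → W ≡[ (λ e → kind e ≢ inT) ] W′ → ∀ I → H W I ≈ H W′ I
      H-local {W} {W′} W≡W′ I = *-cong
        (reflexive (indicator-agree-cong inputEdge {W} {W′} (λ u → W≡W′ _ (kind-inT (proj₁ (inputEnd u))
          (≡.trans (≡.cong side (proj₁ (proj₂ (inputEnd u)))) (side-input u)))) I))
        (∏.sum-cong-≋ tˢ-local)
        where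
        tˢ-local : ∀ v → tˢ W v ≈ tˢ W′ v
        tˢ-local v with side (vertex v) in eq
        ... | false = refl
        ... | true  = reflexive (≡.cong (𝒯 v) (restrict-cong (edgeAt v) {W} {W′} λ i → W≡W′ _
          (kind-inT (proj₁ (Inverse.to (ordering v) i)) (≡.trans (≡.cong side (endAt v i)) eq))))

      β-Rank≤ : Rank≤ (weight capacity kind) (β G 𝒯)
      β-Rank≤ = Rank≤-cong β-split (Rank≤-∑Index capacity capacity>0 kind F H
        (λ {W} {W′} → F-local {W} {W′}) (λ {W} {W′} → H-local {W} {W′}))

  rank≤cutCapacity : ∀ 𝒯 {r} → HasRank (β G 𝒯) r → ∀ C → IsEdgeCutSet G C → r ≤ cutCapacity G C
  rank≤cutCapacity 𝒯 rank C (side , side-input , side-output , C⇔) =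
    ≡.subst (_ ≤_) (≡.sym (weight-filter side side-input side-output id (Subset._∈? C)
        (λ e → mk⇔ (Equivalence.from (kind-cut side side-input side-output e) ∘ Equivalence.to (C⇔ e))
                   (Equivalence.from (C⇔ e) ∘ Equivalence.to (kind-cut side side-input side-output e)))))
      (HasRank⇒≤ (β-Rank≤ side side-input side-output 𝒯) rank)

-- Indicators, and sums with a single nonzero term

if-yes : ∀ {P A : Set} (P? : Dec P) {x y : A} → P → (if does P? then x else y) ≡ x
if-yes P? {x} {y} p = ≡.cong (if_then x else y) (dec-true P? p)

if-no : ∀ {P A : Set} (P? : Dec P) {x y : A} → ¬ P → (if does P? then x else y) ≡ y
if-no P? {x} {y} ¬p = ≡.cong (if_then x else y) (dec-false P? ¬p)

does-true : ∀ {P : Set} (P? : Dec P) → does P? ≡ true → P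
does-true (yes p) _ = p

indicator-yes : ∀ {P : Set} (P? : Dec P) → P → indicator P? ≡ 1#
indicator-yes P? = if-yes P?

indicator-no : ∀ {P : Set} (P? : Dec P) → ¬ P → indicator P? ≡ 0#
indicator-no P? = if-no P?

∏-one : ∀ {n} {f : Fin n → ℂ} → (∀ i → f i ≈ 1#) → ∏ f ≈ 1#
∏-one {zero}  _   = refl
∏-one {suc n} f≈1 = trans (*-cong (f≈1 zero) (∏-one (f≈1 ∘ suc))) (*-identityˡ 1#)

∏-zero : ∀ {n} {f : Fin n → ℂ} i → f i ≈ 0# → ∏ f ≈ 0#
∏-zero zero    f≈0 = trans (*-congʳ f≈0) (zeroˡ _)
∏-zero (suc i) f≈0 = trans (*-congˡ (∏-zero i f≈0)) (zeroʳ _)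

∑-single : ∀ {n} {f : Fin n → ℂ} i → (∀ j → j ≢ i → f j ≈ 0#) → ∑ f ≈ f i
∑-single {suc n} {f} i f≈0 = trans (sum-remove {n} {i} f)
  (trans (+-congˡ (sum-zero λ j → f≈0 (punchIn i j) (Fin.punchInᵢ≢i i j))) (+-identityʳ (f i)))

∑All-zero : ∀ {n} {cs : Vec ℕ n} {f : All Fin cs → ℂ} → (∀ W → f W ≈ 0#) → ∑All f ≈ 0#
∑All-zero {cs = []}    f≈0 = f≈0 []
∑All-zero {cs = c ∷ _} f≈0 = sum-zero {c} λ i → ∑All-zero λ W → f≈0 (i ∷ W)

∑All-single : ∀ {n} {cs : Vec ℕ n} {f : All Fin cs → ℂ} W → (∀ W′ → W′ ≢ W → f W′ ≈ 0#) → ∑All f ≈ f W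
∑All-single {cs = []}         []      f≈0 = refl
∑All-single {cs = c ∷ _} {f} (i ∷ W) f≈0 = trans
  (∑-single {c} i λ j j≢i → ∑All-zero λ W′ → f≈0 (j ∷ W′) λ { ≡.refl → j≢i ≡.refl })
  (∑All-single W λ W′ W′≢W → f≈0 (i ∷ W′) λ { ≡.refl → W′≢W ≡.refl })

*-distribˡ-∑All : ∀ {n} {cs : Vec ℕ n} a (f : All Fin cs → ℂ) → a * ∑All f ≈ ∑All λ W → a * f W
*-distribˡ-∑All {cs = []}    a f = refl
*-distribˡ-∑All {cs = c ∷ _} a f = trans (*-distribˡ-sum {c} a (λ i → ∑All (f ∘ (i ∷_))))
  (sum-cong-≋ {c} λ i → *-distribˡ-∑All a (f ∘ (i ∷_)))

anyIndex? : ∀ {n} {cs : Vec ℕ n} {P : All Fin cs → Set} → Decidable P → Dec (∃ P)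
anyIndex? {cs = []} P? with P? []
... | yes p = yes ([] , p)
... | no ¬p = no λ { ([] , p) → ¬p p }
anyIndex? {cs = _ ∷ _} P? with any? (λ i → anyIndex? λ W → P? (i ∷ W))
... | yes (i , W , p) = yes (i ∷ W , p)
... | no ¬p           = no λ { (i ∷ W , p) → ¬p (i , W , p) }

_≟ᴵ_ : ∀ {n} {c : Fin n → ℕ} (I J : Index c) → Dec (∀ i → tabulate⁻ I i ≡ tabulate⁻ J i)
I ≟ᴵ J = all? λ i → tabulate⁻ I i Fin.≟ tabulate⁻ J i

-- A rank factorisation M = Σₓ |b x⟩⟨a x|, in which the b x and the a x are independent because
-- basis vectors are dual to them.
factorisation⇒HasRank : ∀ {m n} {c : Fin m → ℕ} {c′ : Fin n → ℕ} {M : Hom c c′} {r}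
  (b : Fin r → Index c′ → ℂ) (a : Fin r → Index c → ℂ) →
  (∀ J I → M J I ≈ ∑ λ x → b x J * a x I) →
  (J : Fin r → Index c′) → (∀ x → b x (J x) ≈ 1#) → (∀ x y → x ≢ y → b x (J y) ≈ 0#) →
  (I : Fin r → Index c) → (∀ x → a x (I x) ≈ 1#) → (∀ x y → x ≢ y → a x (I y) ≈ 0#) →
  HasRank M r
factorisation⇒HasRank {c = c} {c′} {M} {r} b a M≈ J b≈1 b≈0 I a≈1 a≈0 =
  b , (λ y → unit y , image y) , independent , span
  where
  unit : Fin r → Tensor c
  unit y K = indicator (_≟ᴵ_ {c = c} K (I y))
  image : ∀ y K → b y K ≈ apply {c = c} {c′} M (unit y) K
  image y K = sym (begin
    ∑All (λ L → M K L * unit y L)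
      ≈⟨ ∑All-single (I y) (λ L L≢ → trans (*-congˡ (reflexive (indicator-no (_≟ᴵ_ {c = c} L (I y)) (L≢ ∘ Index-ext)))) (zeroʳ _)) ⟩
    M K (I y) * unit y (I y)          ≈⟨ *-congˡ (reflexive (indicator-yes (_≟ᴵ_ {c = c} (I y) (I y)) λ _ → ≡.refl)) ⟩
    M K (I y) * 1#                    ≈⟨ *-identityʳ _ ⟩
    M K (I y)                         ≈⟨ M≈ K (I y) ⟩
    ∑ (λ x → b x K * a x (I y))       ≈⟨ ∑-single {r} y (λ x x≢y → trans (*-congˡ (a≈0 x y x≢y)) (zeroʳ _)) ⟩
    b y K * a y (I y)                 ≈⟨ *-congˡ (a≈1 y) ⟩
    b y K * 1#                        ≈⟨ *-identityʳ _ ⟩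
    b y K                             ∎)
  independent : LinearlyIndependent b
  independent α α≈0 y = begin
    α y                             ≈⟨ *-identityʳ _ ⟨
    α y * 1#                        ≈⟨ *-congˡ (b≈1 y) ⟨
    α y * b y (J y)                 ≈⟨ ∑-single {r} y (λ x x≢y → trans (*-congˡ (b≈0 x y x≢y)) (zeroʳ _)) ⟨
    ∑ (λ x → α x * b x (J y))       ≈⟨ α≈0 (J y) ⟩
    0#                              ∎
  span : ∀ w → InImage {c = c} {c′} M w → ∃ λ α → w ≋ combination α b
  span w (v , w≈) = (λ x → ∑Index c λ L → a x L * v L) , λ K → begin
    w K                                                ≈⟨ w≈ K ⟩
    ∑All (λ L → M K L * v L)                           ≈⟨ ∑All-cong (λ L → *-congʳ (M≈ K L)) ⟩
    ∑All (λ L → ∑ (λ x → b x K * a x L) * v L)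
      ≈⟨ ∑All-cong (λ L → trans (*-distribʳ-sum {r} (v L) (λ x → b x K * a x L))
                                (sum-cong-≋ {r} λ x → *-assoc (b x K) (a x L) (v L))) ⟩
    ∑All (λ L → ∑ λ x → b x K * (a x L * v L))         ≈⟨ ∑-∑All-comm {r} (λ x L → b x K * (a x L * v L)) ⟨
    ∑ (λ x → ∑All λ L → b x K * (a x L * v L))         ≈⟨ sum-cong-≋ {r} (λ x → *-distribˡ-∑All (b x K) (λ L → a x L * v L)) ⟨
    ∑ (λ x → b x K * ∑All λ L → a x L * v L)           ≈⟨ sum-cong-≋ {r} (λ x → *-comm (b x K) _) ⟩
    ∑ (λ x → (∑All λ L → a x L * v L) * b x K)         ∎

funToFin-cong : ∀ {m n} {f g : Fin m → Fin n} → (∀ i → f i ≡ g i) → funToFin f ≡ funToFin g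
funToFin-cong {zero}  f≡g = ≡.refl
funToFin-cong {suc m} f≡g = ≡.cong₂ combine (f≡g zero) (funToFin-cong (f≡g ∘ suc))

finToFun-injective : ∀ {m n} {a b : Fin (m ^ n)} → (∀ i → finToFun {m} {n} a i ≡ finToFun b i) → a ≡ b
finToFun-injective {m} {n} {a} {b} eq = ≡.trans (≡.sym (funToFin-finToFin {n} {m} a))
  (≡.trans (funToFin-cong eq) (funToFin-finToFin {n} {m} b))

-- The assignment given by disjoint walks, and the cut given by a separator

module Strands (G : Template) (d : ℕ) (0<d : 0 < d) (power : ∀ e → ∃ λ m → Template.capacity G e ≡ d ^ m) where
  open Template G

  m : Fin #E → ℕ
  m = proj₁ ∘ power

  -- The factors ℂ^d of ℂ^(c e) = (ℂ^d)^⊗(m e)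
  Strand : Set
  Strand = Σ (Fin #E) (Fin ∘ m)

  _≟_ : DecidableEquality Strand
  _≟_ = ≡-dec Fin._≟_ Fin._≟_

  digit : ∀ e → Fin (capacity e) → Fin (m e) → Fin d
  digit e a = finToFun (cast (proj₂ (power e)) a)

  encode : ∀ e → (Fin (m e) → Fin d) → Fin (capacity e)
  encode e f = cast (≡.sym (proj₂ (power e))) (funToFin f)

  digit-encode : ∀ e f j → digit e (encode e f) j ≡ f j
  digit-encode e f j = ≡.trans
    (≡.cong (λ a → finToFun a j) (cast-involutive (proj₂ (power e)) (≡.sym (proj₂ (power e))) (funToFin f)))
    (finToFun-funToFin f j)

  digit-injective : ∀ e {a b} → (∀ j → digit e a j ≡ digit e b j) → a ≡ b
  digit-injective e {a} {b} eq = ≡.trans (≡.sym (cast-involutive _ (proj₂ (power e)) a))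
    (≡.trans (≡.cong (cast (≡.sym (proj₂ (power e)))) (finToFun-injective {d} {m e} eq))
             (cast-involutive _ (proj₂ (power e)) b))

  inputEdge≡ : ∀ {u h} → endpoint h ≡ input u → inputEdge u ≡ proj₁ h
  inputEdge≡ {u} eq = ≡.cong proj₁ (proj₂ (proj₂ (inputEnd u)) eq)

  outputEdge≡ : ∀ {u h} → endpoint h ≡ output u → outputEdge u ≡ proj₁ h
  outputEdge≡ {u} eq = ≡.cong proj₁ (proj₂ (proj₂ (outputEnd u)) eq)

  edgeAt≡ : ∀ {v h} → endpoint h ≡ vertex v → ∃ λ i → edgeAt v i ≡ proj₁ h
  edgeAt≡ {v} {h} eq = Inverse.from (ordering v) (h , eq) ,
    ≡.cong (proj₁ ∘ proj₁) (Inverse.strictlyInverseˡ (ordering v) (h , eq))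

  Input Output AtVertex : Strand → Set
  Input    s = ∃ λ u → inputEdge u ≡ proj₁ s
  Output   s = ∃ λ u → outputEdge u ≡ proj₁ s
  AtVertex s = ∃₂ λ v i → edgeAt v i ≡ proj₁ s

  input? : Decidable Input
  input? s = any? λ u → inputEdge u Fin.≟ proj₁ s

  output? : Decidable Output
  output? s = any? λ u → outputEdge u Fin.≟ proj₁ s

  atVertex? : Decidable AtVertex
  atVertex? s = any? λ v → any? λ i → edgeAt v i Fin.≟ proj₁ s

  -- Symmetric, like the line graph: walks of strands have no preferred direction through a vertex.
  Adjacent : Rel Strand 0ℓ
  Adjacent s s′ = ∃ λ v → (∃ λ i → edgeAt v i ≡ proj₁ s) × (∃ λ i → edgeAt v i ≡ proj₁ s′)

  adjacent? : ∀ s s′ → Dec (Adjacent s s′)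
  adjacent? s s′ = any? λ v → any? (λ i → edgeAt v i Fin.≟ proj₁ s) ×-dec any? (λ i → edgeAt v i Fin.≟ proj₁ s′)

  strandsOn : List (Fin #E) → List Strand
  strandsOn []       = []
  strandsOn (e ∷ es) = List.map (e ,_) (allFin (m e)) ++ strandsOn es

  ∈-strandsOn⁺ : ∀ {es e} j → e ∈ es → (e , j) ∈ strandsOn es
  ∈-strandsOn⁺ j (here ≡.refl) = ∈-++⁺ˡ (∈-map⁺ _ (∈-allFin j))
  ∈-strandsOn⁺ j (there e∈)    = ∈-++⁺ʳ _ (∈-strandsOn⁺ j e∈)

  ∈-strandsOn⁻ : ∀ {s} es → s ∈ strandsOn es → proj₁ s ∈ es
  ∈-strandsOn⁻ (e ∷ es) s∈ with ∈-++⁻ (List.map (e ,_) (allFin (m e))) s∈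
  ... | inj₁ s∈ˡ = here (≡.cong proj₁ (proj₂ (proj₂ (∈-map⁻ _ s∈ˡ))))
  ... | inj₂ s∈ʳ = there (∈-strandsOn⁻ es s∈ʳ)

  strandsOn-unique : ∀ {es} → Unique es → Unique (strandsOn es)
  strandsOn-unique [] = []
  strandsOn-unique {e ∷ es} (e∉ ∷ unique) = Unique.++⁺
    (Unique.map⁺ (λ { ≡.refl → ≡.refl }) (Unique.allFin⁺ (m e))) (strandsOn-unique unique)
    λ (s∈ˡ , s∈ʳ) → ListAll.lookup e∉ (∈-strandsOn⁻ es s∈ʳ) (≡.sym (≡.cong proj₁ (proj₂ (proj₂ (∈-map⁻ _ s∈ˡ)))))

  length-strandsOn : ∀ e es → length (strandsOn (e ∷ es)) ≡ m e ℕ.+ length (strandsOn es)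
  length-strandsOn e es = ≡.trans (length-++ (List.map (e ,_) (allFin (m e))) {strandsOn es})
    (≡.cong (ℕ._+ length (strandsOn es))
      (≡.trans (length-map {B = Strand} (e ,_) (allFin (m e))) (length-tabulate {n = m e} id)))

  product-capacity : ∀ es → product (List.map capacity es) ≡ d ^ length (strandsOn es)
  product-capacity []       = ≡.refl
  product-capacity (e ∷ es) = ≡.trans (≡.cong₂ ℕ._*_ (proj₂ (power e)) (product-capacity es))
    (≡.trans (≡.sym (ℕ.^-distribˡ-+-* d (m e) (length (strandsOn es))))
             (≡.cong (d ^_) (≡.sym (length-strandsOn e es))))

  -- The rank attained by disjoint walks

  module _ {k} (linkage : Linkage Adjacent Input Output k) where
    open Linkage linkage

    _∈ʷᵏ?_ : ∀ s p → Dec (s ∈ʷ walk p)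
    s ∈ʷᵏ? p = _∈ʷ?_ _≟_ s (walk p)

    OnWalk : Strand → Set
    OnWalk s = ∃ λ p → s ∈ʷ walk p

    onWalk? : Decidable OnWalk
    onWalk? s = any? (s ∈ʷᵏ?_)

    word : Fin (d ^ k) → Fin k → Fin d
    word = finToFun

    value : Fin (d ^ k) → Strand → Fin d
    value x s with onWalk? s
    ... | yes (p , _) = word x p
    ... | no _        = fromℕ< 0<d

    value-on : ∀ x {s p} → s ∈ʷ walk p → value x s ≡ word x p
    value-on x {s} s∈ with onWalk? s
    ... | yes (_ , s∈′) = ≡.cong (word x) (disjoint s∈′ s∈)
    ... | no s∉         = contradiction (_ , s∈) s∉

    -- A strand off the walks that joins two inputs or two outputs meets no tensor, so its digit is free.
    Constrained : Strand → Set
    Constrained s = OnWalk s ⊎ AtVertex s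

    digitOf : Index capacity → Strand → Fin d
    digitOf W (e , j) = digit e (tabulate⁻ W e) j

    Valid : Fin (d ^ k) → Index capacity → Set
    Valid x W = ∀ e j → Constrained (e , j) → digitOf W (e , j) ≡ value x (e , j)

    valid? : ∀ x W → Dec (Valid x W)
    valid? x W = all? λ e → all? λ j →
      (onWalk? (e , j) ⊎-dec atVertex? (e , j)) →-dec (digitOf W (e , j) Fin.≟ value x (e , j))

    -- The word `x` may differ from vertex to vertex. A tensor sees only the walks passing its
    -- vertex; agreement between vertices comes from the strands they share.
    Local : ∀ v → Index (capacity ∘ edgeAt v) → Set
    Local v I = ∃ λ x → ∀ i j → digit (edgeAt v i) (tabulate⁻ {f = capacity ∘ edgeAt v} I i) j ≡ value x (edgeAt v i , j)

    local? : ∀ v I → Dec (Local v I)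
    local? v I = any? λ x → all? λ i → all? λ j →
      digit (edgeAt v i) (tabulate⁻ {f = capacity ∘ edgeAt v} I i) j Fin.≟ value x (edgeAt v i , j)

    𝒯 : TensorAssignment G
    𝒯 v I = indicator (local? v I)

    Everywhere : Index capacity → Set
    Everywhere W = ∀ v → Local v (restrict G (edgeAt v) W)

    tabulate⁻-restrict : ∀ {n} (e : Fin n → Fin #E) W i → tabulate⁻ (restrict G e W) i ≡ tabulate⁻ W (e i)
    tabulate⁻-restrict e W i = tabulate⁻-tabulate⁺ (λ i → tabulate⁻ W (e i)) i

    valid⇒everywhere : ∀ {x W} → Valid x W → Everywhere W
    valid⇒everywhere {x} {W} valid v = x , λ i j → ≡.trans
      (≡.cong (λ a → digit (edgeAt v i) a j) (tabulate⁻-restrict (edgeAt v) W i))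
      (valid (edgeAt v i) j (inj₂ (v , i , ≡.refl)))

    -- Consecutive strands of a walk meet at a vertex whose tensor gives both the same digit, so
    -- digits are constant along walks. The word can therefore be read off at the starts.
    everywhere⇒valid : ∀ {W} → Everywhere W → ∃ λ x → Valid x W
    everywhere⇒valid {W} everywhere = x , valid
      where
      x : Fin (d ^ k)
      x = funToFin λ p → digitOf W (start p)
      local : ∀ v {s} → (∃ λ i → edgeAt v i ≡ proj₁ s) → digitOf W s ≡ value (proj₁ (everywhere v)) s
      local v {_ , j} (i , ≡.refl) = ≡.trans
        (≡.cong (λ a → digit (edgeAt v i) a j) (≡.sym (tabulate⁻-restrict (edgeAt v) W i)))
        (proj₂ (everywhere v) i j)
      along : ∀ {p s s′} (w : Star Adjacent s s′) → w ⊆ʷ walk p → ∀ {t} → t ∈ʷ w → digitOf W t ≡ digitOf W s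
      along RTC.ε w⊆ ≡.refl = ≡.refl
      along (_ ◅ _) w⊆ (inj₁ ≡.refl) = ≡.refl
      along ((v , at , at′) ◅ w) w⊆ (inj₂ t∈) = ≡.trans (along w (w⊆ ∘ inj₂) t∈)
        (≡.trans (local v at′) (≡.trans (value-on _ (w⊆ (inj₂ (start∈ w))))
          (≡.sym (≡.trans (local v at) (value-on _ (w⊆ (inj₁ ≡.refl)))))))
      on : ∀ {s p} → s ∈ʷ walk p → digitOf W s ≡ value x s
      on {p = p} s∈ = ≡.trans (along (walk p) id s∈)
        (≡.sym (≡.trans (value-on x s∈) (finToFun-funToFin (λ p → digitOf W (start p)) p)))
      valid : Valid x W
      valid e j (inj₁ (p , s∈)) = on s∈
      valid e j (inj₂ (v , at)) with onWalk? (e , j) in eq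
      ... | yes (p , s∈) = ≡.trans (on s∈) (value-on x s∈)
      -- Off the walks `value` is the zero digit for every word, so the word used locally at `v` may
      -- be replaced by `x`.
      ... | no s∉ = ≡.trans (local v at) (off eq)
        where
        off : ∀ {y} → onWalk? (e , j) ≡ no s∉ → value y (e , j) ≡ fromℕ< 0<d
        off eq rewrite eq = ≡.refl

    word-unique : ∀ {x x′ W W′} → Valid x W → Valid x′ W′ → (t : Fin k → Strand) → (∀ p → t p ∈ʷ walk p) →
                  (∀ p → tabulate⁻ W (proj₁ (t p)) ≡ tabulate⁻ W′ (proj₁ (t p))) → x ≡ x′
    word-unique {x} {x′} valid valid′ t t∈ W≡W′ = finToFun-injective {d} {k} λ p → ≡.trans
      (≡.sym (≡.trans (valid _ _ (inj₁ (p , t∈ p))) (value-on x (t∈ p))))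
      (≡.trans (≡.cong (λ a → digit _ a _) (W≡W′ p))
               (≡.trans (valid′ _ _ (inj₁ (p , t∈ p))) (value-on x′ (t∈ p))))

    input-word : ∀ {x x′ W W′ I} → Valid x W → Valid x′ W′ → Agree G inputEdge W I → Agree G inputEdge W′ I → x ≡ x′
    input-word {W = W} {W′} valid valid′ W~I W′~I = word-unique {W = W} {W′} valid valid′ start (start∈ ∘ walk)
      λ p → let u , eq = start-A p in
        ≡.subst (λ e → tabulate⁻ W e ≡ tabulate⁻ W′ e) eq (≡.trans (W~I u) (≡.sym (W′~I u)))

    output-word : ∀ {x x′ W W′ J} → Valid x W → Valid x′ W′ → Agree G outputEdge W J → Agree G outputEdge W′ J → x ≡ x′
    output-word {W = W} {W′} valid valid′ W~J W′~J = word-unique {W = W} {W′} valid valid′ end (end∈ ∘ walk)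
      λ p → let u , eq = end-B p in
        ≡.subst (λ e → tabulate⁻ W e ≡ tabulate⁻ W′ e) eq (≡.trans (W~J u) (≡.sym (W′~J u)))

    Contributes : Index (capacity ∘ outputEdge) → Index (capacity ∘ inputEdge) → Index capacity → Set
    Contributes J I W = (Agree G inputEdge W I × Agree G outputEdge W J) × Everywhere W

    contributes? : ∀ J I → Decidable (Contributes J I)
    contributes? J I W = (agree? G inputEdge W I ×-dec agree? G outputEdge W J) ×-dec all? λ v → local? v (restrict G (edgeAt v) W)

    -- The input indices determine the word, and the word determines every digit that a tensor sees.
    contributes-unique : ∀ {J I W W′} → Contributes J I W → Contributes J I W′ → W ≡ W′
    contributes-unique {J} {I} {W} {W′} ((W~I , W~J) , everywhere) ((W′~I , W′~J) , everywhere′) = Index-ext same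
      where
      x = everywhere⇒valid {W} everywhere
      x′ = everywhere⇒valid {W′} everywhere′
      x≡x′ : proj₁ x ≡ proj₁ x′
      x≡x′ = input-word {W = W} {W′} {I} (proj₂ x) (proj₂ x′) W~I W′~I
      same : ∀ e → tabulate⁻ W e ≡ tabulate⁻ W′ e
      -- One end of `e` is enough: an open end fixes the index through `I` or `J`, and an end at a
      -- vertex makes all strands of `e` constrained.
      same e with endpoint (e , 0F) in eq
      ... | input u  = ≡.subst (λ e → tabulate⁻ W e ≡ tabulate⁻ W′ e) (inputEdge≡ eq)
                         (≡.trans (W~I u) (≡.sym (W′~I u)))
      ... | output u = ≡.subst (λ e → tabulate⁻ W e ≡ tabulate⁻ W′ e) (outputEdge≡ eq)
                         (≡.trans (W~J u) (≡.sym (W′~J u)))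
      ... | vertex v = digit-injective e λ j → ≡.trans (proj₂ x e j (inj₂ at))
                         (≡.trans (≡.cong (λ x → value x (e , j)) x≡x′) (≡.sym (proj₂ x′ e j (inj₂ at))))
        where
        at : ∃₂ λ v i → edgeAt v i ≡ e
        at = v , edgeAt≡ eq

    InputWord : Fin (d ^ k) → Index (capacity ∘ inputEdge) → Set
    InputWord x I = ∃ λ W → Valid x W × Agree G inputEdge W I

    OutputWord : Fin (d ^ k) → Index (capacity ∘ outputEdge) → Set
    OutputWord x J = ∃ λ W → Valid x W × Agree G outputEdge W J

    inputWord? : ∀ x I → Dec (InputWord x I)
    inputWord? x I = anyIndex? λ W → valid? x W ×-dec agree? G inputEdge W I

    outputWord? : ∀ x J → Dec (OutputWord x J)
    outputWord? x J = anyIndex? λ W → valid? x W ×-dec agree? G outputEdge W J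

    module _ (linked : ∀ {s} → Input s → Output s → OnWalk s) where

      -- Input edges are taken from `W`, all others from `W′`. The two can conflict only on an edge
      -- joining an input to an output; by `linked` its strands lie on walks, so both configurations
      -- give it the digits prescribed by `x`.
      glue : ∀ {x I J} → InputWord x I → OutputWord x J → ∃ (Contributes J I)
      glue {x} {I} {J} (W , valid , W~I) (W′ , valid′ , W′~J) =
        U , (U~I , U~J) , valid⇒everywhere {x} {U} U-valid
        where
        onInput? : ∀ e → Dec (∃ λ u → inputEdge u ≡ e)
        onInput? e = any? λ u → inputEdge u Fin.≟ e
        pick : ∀ {e} → Dec (∃ λ u → inputEdge u ≡ e) → Fin (capacity e)
        pick {e} (yes _) = tabulate⁻ W e
        pick {e} (no _)  = tabulate⁻ W′ e
        U : Index capacity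
        U = tabulate⁺ (pick ∘ onInput?)
        U-at : ∀ e → tabulate⁻ U e ≡ pick (onInput? e)
        U-at = tabulate⁻-tabulate⁺ (pick ∘ onInput?)
        U-valid : Valid x U
        U-valid e j constrained = ≡.trans (≡.cong (λ a → digit e a j) (U-at e)) (picked (onInput? e))
          where
          picked : ∀ e? → digit e (pick e?) j ≡ value x (e , j)
          picked (yes _) = valid e j constrained
          picked (no _)  = valid′ e j constrained
        U~I : Agree G inputEdge U I
        U~I u = ≡.trans (U-at (inputEdge u)) (picked (onInput? (inputEdge u)))
          where
          picked : ∀ e? → pick e? ≡ tabulate⁻ I u
          picked (yes _)   = W~I u
          picked (no none) = contradiction (u , ≡.refl) none
        U~J : Agree G outputEdge U J
        U~J u = ≡.trans (U-at (outputEdge u)) (picked (onInput? (outputEdge u)))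
          where
          picked : ∀ e? → pick e? ≡ tabulate⁻ J u
          picked (no _)      = W′~J u
          picked (yes onInput) = ≡.trans
            (digit-injective (outputEdge u) λ j → let on = inj₁ (linked onInput (u , ≡.refl)) in
              ≡.trans (valid _ j on) (≡.sym (valid′ _ j on)))
            (W′~J u)

      module _ (J : Index (capacity ∘ outputEdge)) (I : Index (capacity ∘ inputEdge)) where

        term : Index capacity → ℂ
        term W = if does (agree? G inputEdge W I ×-dec agree? G outputEdge W J)
                 then ∏ (λ v → 𝒯 v (restrict G (edgeAt v) W))
                 else 0#

        agrees? : ∀ W → Dec (Agree G inputEdge W I × Agree G outputEdge W J)
        agrees? W = agree? G inputEdge W I ×-dec agree? G outputEdge W J

        term-one : ∀ W → Contributes J I W → term W ≈ 1#
        term-one W (agree , everywhere) = trans (reflexive (if-yes (agrees? W) agree))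
          (∏-one λ v → reflexive (indicator-yes (local? v (restrict G (edgeAt v) W)) (everywhere v)))

        term-zero : ∀ W → ¬ Contributes J I W → term W ≈ 0#
        term-zero W ¬c = case agrees? W of λ where
          (no ¬agree) → reflexive (if-no (agrees? W) ¬agree)
          (yes agree) → trans (reflexive (if-yes (agrees? W) agree))
            (let v , ¬local = Fin.¬∀⟶∃¬ _ _ (λ v → local? v (restrict G (edgeAt v) W))
                              (λ everywhere → ¬c (agree , everywhere))
             in ∏-zero v (reflexive (indicator-no (local? v (restrict G (edgeAt v) W)) ¬local)))

        summand : Fin (d ^ k) → ℂ
        summand x = indicator (outputWord? x J) * indicator (inputWord? x I)

        summand-zero : ∀ x → ¬ (OutputWord x J × InputWord x I) → summand x ≈ 0#
        summand-zero x ¬both with outputWord? x J | inputWord? x I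
        ... | yes o | yes i = contradiction (o , i) ¬both
        ... | no _  | yes _ = zeroˡ 1#
        ... | _     | no _  = zeroʳ _

        -- Both sides are 0 or 1. Contributing configurations are unique, and one exists exactly
        -- when some word fits both `I` and `J`; that word is unique as well.
        β-factorisation : β G 𝒯 J I ≈ ∑ summand
        β-factorisation with anyIndex? (contributes? J I)
        ... | no none = trans (∑All-zero λ W → term-zero W λ c → none (W , c))
                              (sym (sum-zero {d ^ k} λ x → summand-zero x λ (o , i) → none (glue {x} {I} {J} i o)))
        ... | yes (W , c@((W~I , W~J) , everywhere)) with x , valid ← everywhere⇒valid {W} everywhere = begin
          ∑All term    ≈⟨ ∑All-single W (λ W′ W′≢W → term-zero W′ λ c′ → W′≢W (contributes-unique {J} {I} c′ c)) ⟩
          term W       ≈⟨ term-one W c ⟩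
          1#           ≈⟨ *-identityˡ 1# ⟨
          1# * 1#      ≡⟨ ≡.cong₂ _*_ (indicator-yes (outputWord? x J) (W , valid , W~J))
                                       (indicator-yes (inputWord? x I) (W , valid , W~I)) ⟨
          summand x    ≈⟨ ∑-single {d ^ k} x (λ x′ x′≢x → summand-zero x′ λ (_ , W′ , valid′ , W′~I) →
                            x′≢x (input-word {W = W′} {W} {I} valid′ valid W′~I W~I)) ⟨
          ∑ summand    ∎

      configuration : Fin (d ^ k) → Index capacity
      configuration x = tabulate⁺ λ e → encode e λ j → value x (e , j)

      configuration-valid : ∀ x → Valid x (configuration x)
      configuration-valid x e j _ = ≡.trans
        (≡.cong (λ a → digit e a j) (tabulate⁻-tabulate⁺ (λ e → encode e λ j → value x (e , j)) e))
        (digit-encode e (λ j → value x (e , j)) j)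

      restrict-agree : ∀ {n} (e : Fin n → Fin #E) W → Agree G e W (restrict G e W)
      restrict-agree e W u = ≡.sym (tabulate⁻-restrict e W u)

      β-rank : HasRank (β G 𝒯) (d ^ k)
      β-rank = factorisation⇒HasRank {M = β G 𝒯}
        (λ x J → indicator (outputWord? x J)) (λ x I → indicator (inputWord? x I)) β-factorisation
        outputs
        (λ x → reflexive (indicator-yes (outputWord? x (outputs x))
          (configuration x , configuration-valid x , restrict-agree outputEdge (configuration x))))
        (λ x y x≢y → reflexive (indicator-no (outputWord? x (outputs y)) λ (W , valid , W~) →
          x≢y (output-word {W = W} {configuration y} {outputs y} valid (configuration-valid y) W~
                (restrict-agree outputEdge (configuration y)))))
        inputs
        (λ x → reflexive (indicator-yes (inputWord? x (inputs x))
          (configuration x , configuration-valid x , restrict-agree inputEdge (configuration x))))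
        (λ x y x≢y → reflexive (indicator-no (inputWord? x (inputs y)) λ (W , valid , W~) →
          x≢y (input-word {W = W} {configuration y} {inputs y} valid (configuration-valid y) W~
                (restrict-agree inputEdge (configuration y)))))
        where
        outputs = restrict G outputEdge ∘ configuration
        inputs  = restrict G inputEdge ∘ configuration

  -- Menger's theorem for the strands

  allStrands : List Strand
  allStrands = strandsOn (allFin #E)

  allStrands-complete : ∀ s → s ∈ allStrands
  allStrands-complete (e , j) = ∈-strandsOn⁺ j (∈-allFin e)

  -- The adjacency relation as an explicit list, because `menger` proceeds by induction on the list
  -- of edges.
  adjacencies : List (Strand × Strand)
  adjacencies = List.filter (λ (s , s′) → adjacent? s s′) (List.cartesianProduct allStrands allStrands)

  ∈-adjacencies⁺ : ∀ {s s′} → Adjacent s s′ → (s , s′) ∈ adjacencies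
  ∈-adjacencies⁺ {s} {s′} = ∈-filter⁺ (λ (s , s′) → adjacent? s s′)
    (∈-cartesianProduct⁺ (allStrands-complete s) (allStrands-complete s′))

  ∈-adjacencies⁻ : ∀ {s s′} → (s , s′) ∈ adjacencies → Adjacent s s′
  ∈-adjacencies⁻ s∈ = proj₂ (∈-filter⁻ (λ (s , s′) → adjacent? s s′) {xs = List.cartesianProduct allStrands allStrands} s∈)

  linkage∧separator : ∃₂ λ k n → n ≤ k × Linkage Adjacent Input Output k × Separator Adjacent Input Output n
  linkage∧separator =
    let k , n , n≤k , linkage , separator = menger _≟_ allStrands (strandsOn-unique (Unique.allFin⁺ #E))
                                              allStrands-complete adjacencies input? output?
    in k , n , n≤k , mapLinkage ∈-adjacencies⁻ linkage , mapSeparator ∈-adjacencies⁺ separator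

  -- The edge cut set of a separator

  module _ {n} (separator : Separator Adjacent Input Output n) where
    open Separator separator renaming (cut to cutset)

    -- One reached strand puts a vertex into S̄. All strands at that vertex are adjacent to it, so
    -- each of them is reached or belongs to the separator.
    ReachedAt : Fin #V → Set
    ReachedAt v = ∃₂ λ i j → Reached (edgeAt v i , j)

    reachedAt? : Decidable ReachedAt
    reachedAt? v = any? λ i → any? λ j → reached? (edgeAt v i , j)

    side : Node #S #T #V → Bool
    side (input _)  = true
    side (output _) = false
    side (vertex v) = does (reachedAt? v)

    S̄-end : ∀ h j → side (endpoint h) ≡ true → (proj₁ h , j) ∈ᶠ cutset ⊎ Reached (proj₁ h , j)
    S̄-end h j eq with endpoint h in at
    ... | input u  = source (u , inputEdge≡ at)
    ... | vertex v with yes (i , j′ , reached) ← reachedAt? v =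
      step reached (v , (i , ≡.refl) , edgeAt≡ at)

    T̄-end : ∀ h j → side (endpoint h) ≡ false → ¬ Reached (proj₁ h , j)
    T̄-end h j eq reached with endpoint h in at
    ... | output u = target reached (u , outputEdge≡ at)
    ... | vertex v with no ¬reachedAt ← reachedAt? v with i , ≡.refl ← edgeAt≡ at = ¬reachedAt (i , j , reached)

    crosses? : ∀ e → Dec (side (endpoint (e , 0F)) ≢ side (endpoint (e , 1F)))
    crosses? e = ¬? (side (endpoint (e , 0F)) Bool.≟ side (endpoint (e , 1F)))

    -- The end in S̄ makes each strand of the edge reached or separating, and the end in T̄ excludes
    -- reached.
    crossing⊆cutset : ∀ e j → side (endpoint (e , 0F)) ≢ side (endpoint (e , 1F)) → (e , j) ∈ᶠ cutset
    crossing⊆cutset e j ≢ with side (endpoint (e , 0F)) in eq₀ | side (endpoint (e , 1F)) in eq₁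
    ... | true  | true  = contradiction ≡.refl ≢
    ... | false | false = contradiction ≡.refl ≢
    ... | true  | false = [ id , (λ reached → contradiction reached (T̄-end (e , 1F) j eq₁)) ]′ (S̄-end (e , 0F) j eq₀)
    ... | false | true  = [ id , (λ reached → contradiction reached (T̄-end (e , 0F) j eq₀)) ]′ (S̄-end (e , 1F) j eq₁)

    edgeCut : Subset #E
    edgeCut = Vec.tabulate (does ∘ crosses?)

    ∈-edgeCut : ∀ e → e Subset.∈ edgeCut ⇔ side (endpoint (e , 0F)) ≢ side (endpoint (e , 1F))
    ∈-edgeCut e = mk⇔ to from
      where
      lookup≡ : Vec.lookup edgeCut e ≡ does (crosses? e)
      lookup≡ = Vec.lookup∘tabulate (does ∘ crosses?) e
      to : e Subset.∈ edgeCut → _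
      to e∈ = does-true (crosses? e) (≡.trans (≡.sym lookup≡) (Vec.[]=⇒lookup e∈))
      from : _ → e Subset.∈ edgeCut
      from crosses = Vec.lookup⇒[]= e edgeCut (≡.trans lookup≡ (dec-true (crosses? e) crosses))

    isEdgeCutSet : IsEdgeCutSet G edgeCut
    isEdgeCutSet = side , (λ _ → ≡.refl) , (λ _ → ≡.refl) , ∈-edgeCut

    cutEdges : List (Fin #E)
    cutEdges = List.filter (Subset._∈? edgeCut) (allFin #E)

    -- Counting strands instead of edges turns the product of the capacities into a power of `d`,
    -- whose exponent is bounded because distinct strands occupy distinct places of `cutset`.
    cutStrands≤ : length (strandsOn cutEdges) ≤ n
    cutStrands≤ = injective⇒≤ {f = proj₁ ∘ inCutset} λ {i} {j} eq →
      lookup-injective (strandsOn-unique (Unique.filter⁺ (Subset._∈? edgeCut) (Unique.allFin⁺ #E)))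
        (≡.trans (≡.sym (proj₂ (inCutset i))) (≡.trans (≡.cong cutset eq) (proj₂ (inCutset j))))
      where
      inCutset : ∀ i → List.lookup (strandsOn cutEdges) i ∈ᶠ cutset
      inCutset i = crossing⊆cutset _ _ (Equivalence.to (∈-edgeCut _)
        (proj₂ (∈-filter⁻ (Subset._∈? edgeCut) {xs = allFin #E} (∈-strandsOn⁻ cutEdges (∈-lookup i)))))

    cutCapacity≤ : cutCapacity G edgeCut ≤ d ^ n
    cutCapacity≤ = ≡.subst (_≤ d ^ n) (≡.sym (product-capacity cutEdges))
      (ℕ.^-monoʳ-≤ d {{ℕ.>-nonZero 0<d}} cutStrands≤)

theorem3p8 : (G : Template) (d : ℕ) → 0 < d →
    (∀ e → ∃ λ m → Template.capacity G e ≡ d ^ m) →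
    ∃ λ n → IsQMF G n × IsQMC G n
theorem3p8 G d 0<d power = maximise linkage∧separator
  where
  open Strands G d 0<d power
  open CutBound G
  maximise : (∃₂ λ k n → n ≤ k × Linkage Adjacent Input Output k × Separator Adjacent Input Output n) →
             ∃ λ n → IsQMF G n × IsQMC G n
  maximise (k , n , n≤k , linkage , separator) =
    d ^ k ,
    -- The cut `C` of capacity at most `d ^ k` bounds the rank of every assignment; the assignment
    -- of rank `d ^ k` bounds the capacity of every cut from below.
    ((𝒯 linkage , rank) , λ 𝒯′ r rank′ → ℕ.≤-trans (rank≤cutCapacity 𝒯′ rank′ C isCut) C≤) ,
    (C , isCut , ℕ.≤-antisym C≤ (rank≤cutCapacity (𝒯 linkage) rank C isCut)) ,
    rank≤cutCapacity (𝒯 linkage) rank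
    where
    C = edgeCut separator
    isCut : IsEdgeCutSet G C
    isCut = isEdgeCutSet separator
    C≤ : cutCapacity G C ≤ d ^ k
    C≤ = ℕ.≤-trans (cutCapacity≤ separator) (ℕ.^-monoʳ-≤ d {{ℕ.>-nonZero 0<d}} n≤k)
    rank : HasRank (β G (𝒯 linkage)) (d ^ k)
    rank = β-rank linkage
      (source∩target-linked n≤k linkage separator λ s p → _∈ʷ?_ _≟_ s (Linkage.walk linkage p))
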